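{- Let $n\geq 0$ be an integer. Then \[ CP_{(2,1)}(n) = \frac{1}{(q;q)_{2n}} \sum_{r=-\infty}^\infty (-1)^r q^{r(5r+1)/2} {2n \brack n-\frac{5r}{2} + \frac{(-1)^r-1}{4}}_q, \] \[ CP_{(3,0)}(n) = \frac{1}{(q;q)_{2n}} \sum_{r=-\infty}^\infty (-1)^r q^{r(5r+3)/2} {2n \brack n-\frac{5r}{2} + 3\frac{(-1)^r-1}{4}}_q. \]
   Context: $(a;q)_m=\prod_{j=0}^{m-1}(1-aq^j)$. For integers $a,b$, the $q$-binomial coefficient is ${a\brack b}_q=\frac{(q;q)_a}{(q;q)_b(q;q)_{a-b}}$ if $0\le b\le a$ and $0$ otherwise. A cylindric partition with profile $(c_1,c_2)$ (nonnegative integers) is a pair of integer partitions $(\lambda^{(1)},\lambda^{(2)})$ (parts written in weakly decreasing order $\lambda^{(i)}_1\ge\lambda^{(i)}_2\ge\cdots$, with $\lambda^{(i)}_j=0$ beyond the number of parts) such that $\lambda^{(1)}_j\ge\lambda^{(2)}_{j+c_2}$ and $\lambda^{(2)}_j\ge\lambda^{(1)}_{j+c_1}$ for all $j\ge1$. Its size is $|\lambda^{(1)}|+|\lambda^{(2)}|$. For integers $a\ge b\ge0$ and $n\ge0$, $CP_{(a,b)}(n)$ denotes the generating function $\sum q^{\text{size}}$ over cylindric partitions with profile $(a,b)$ in which each of the two partitions has at most $n$ parts; $CP_{(a,b)}(0)=1$. -}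

module Defs where

open import Data.Nat as ℕ using (ℕ; zero; suc; _≤_; _≤?_)
open import Data.Nat.Divisibility using (_∣?_)
open import Data.Nat.Properties using (_≟_)
open import Data.Integer as ℤ using (ℤ; +_; -[1+_]; _/ℕ_; _%ℕ_; ∣_∣)
import Data.Integer.Properties as ℤP
open import Data.Fin using (Fin; toℕ)
open import Data.Fin.Properties using (all?)
open import Data.Vec using (Vec; []; _∷_)
open import Data.List using (List; []; _∷_; map; concatMap; filter; length; upTo)
open import Data.Product using (_×_; _,_; proj₁; proj₂)
open import Relation.Nullary using (Dec; yes; no; _×-dec_)
open import Relation.Binary.PropositionalEquality using (_≡_)

-- Formal power series in q with integer coefficients: N ↦ [q^N] f

FPS : Set
FPS = ℕ → ℤ

sumTo : ℕ → (ℕ → ℤ) → ℤ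
sumTo zero    f = ℤ.0ℤ
sumTo (suc m) f = sumTo m f ℤ.+ f m

_⊛_ : FPS → FPS → FPS
(f ⊛ g) N = sumTo (suc N) (λ i → f i ℤ.* g (N ℕ.∸ i))

infixl 7 _⊛_

oneS : FPS
oneS zero    = ℤ.1ℤ
oneS (suc _) = ℤ.0ℤ

zeroS : FPS
zeroS _ = ℤ.0ℤ

prodTo : ℕ → (ℕ → FPS) → FPS
prodTo zero    f = oneS
prodTo (suc m) f = prodTo m f ⊛ f m

mono : ℤ → FPS
mono e N with + N ℤ.≟ e
... | yes _ = ℤ.1ℤ
... | no  _ = ℤ.0ℤ

oneMinusQ : ℕ → FPS
oneMinusQ j N = oneS N ℤ.- mono (+ j) N

-- 1/(1 - q^(k+1)) = Σ_t q^{(k+1) t}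
geomInv : ℕ → FPS
geomInv k N with suc k ∣? N
... | yes _ = ℤ.1ℤ
... | no  _ = ℤ.0ℤ

qPoch : ℕ → FPS
qPoch m = prodTo m (λ j → oneMinusQ (suc j))

qPochInv : ℕ → FPS
qPochInv m = prodTo m geomInv

qBinom : ℕ → ℕ → FPS
qBinom a b with b ≤? a
... | yes _ = qPoch a ⊛ qPochInv b ⊛ qPochInv (a ℕ.∸ b)
... | no  _ = zeroS

qBinomℤ : ℕ → ℤ → FPS
qBinomℤ a (+ b)    = qBinom a b
qBinomℤ a -[1+ _ ] = zeroS

signPow : ℤ → ℤ
signPow r with ∣ r ∣ ℕ.% 2
... | zero = ℤ.1ℤ
... | suc _ = ℤ.-1ℤ

-- Bilateral sum Σ_{r ∈ ℤ} T r of power series, coefficientwise.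
-- Used only for families with [q^N] T r = 0 whenever |r| > N,
-- so coefficient N is the finite sum over -N ≤ r ≤ N.
sumℤ : (ℤ → FPS) → FPS
sumℤ T N = sumTo (suc (2 ℕ.* N)) (λ i → T ((+ i) ℤ.- (+ N)) N)

-- Right-hand sides.  All divisions below are exact.

term₁ : ℕ → ℤ → FPS
term₁ n r =
  (λ M → signPow r ℤ.* mono ((r ℤ.* (+ 5 ℤ.* r ℤ.+ + 1)) /ℕ 2) M)
    ⊛ qBinomℤ (2 ℕ.* n)
          ((+ 4 ℤ.* + n ℤ.- + 10 ℤ.* r ℤ.+ (signPow r ℤ.- ℤ.1ℤ)) /ℕ 4)

term₂ : ℕ → ℤ → FPS
term₂ n r =
  (λ M → signPow r ℤ.* mono ((r ℤ.* (+ 5 ℤ.* r ℤ.+ + 3)) /ℕ 2) M)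
    ⊛ qBinomℤ (2 ℕ.* n)
          ((+ 4 ℤ.* + n ℤ.- + 10 ℤ.* r ℤ.+ + 3 ℤ.* (signPow r ℤ.- ℤ.1ℤ)) /ℕ 4)

rhs₁ : ℕ → FPS
rhs₁ n = qPochInv (2 ℕ.* n) ⊛ sumℤ (term₁ n)

rhs₂ : ℕ → FPS
rhs₂ n = qPochInv (2 ℕ.* n) ⊛ sumℤ (term₂ n)

-- Cylindric partitions.
-- A partition with at most n parts is a weakly decreasing Vec ℕ n
-- (λ_1 ≥ … ≥ λ_n ≥ 0, parts beyond n are 0).

part : ∀ {n} → Vec ℕ n → ℕ → ℕ
part []       _       = 0
part (x ∷ _)  zero    = x
part (_ ∷ xs) (suc j) = part xs j

size : ∀ {n} → Vec ℕ n → ℕ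
size []       = 0
size (x ∷ xs) = x ℕ.+ size xs

IsPartition : ∀ {n} → Vec ℕ n → Set
IsPartition {n} v = ∀ (i : Fin n) → part v (suc (toℕ i)) ≤ part v (toℕ i)

-- λ^(1)_j ≥ λ^(2)_{j+c2} and λ^(2)_j ≥ λ^(1)_{j+c1} for all j ≥ 1
-- (for j beyond n both right-hand sides are 0, so j ≤ n suffices)
IsCylindric : ℕ → ℕ → ∀ {n} → Vec ℕ n → Vec ℕ n → Set
IsCylindric c₁ c₂ {n} l₁ l₂ =
  (∀ (i : Fin n) → part l₂ (toℕ i ℕ.+ c₂) ≤ part l₁ (toℕ i)) ×
  (∀ (i : Fin n) → part l₁ (toℕ i ℕ.+ c₁) ≤ part l₂ (toℕ i))

IsCP : ℕ → ℕ → (n N : ℕ) → Vec ℕ n × Vec ℕ n → Set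
IsCP c₁ c₂ n N (l₁ , l₂) =
  IsPartition l₁ × IsPartition l₂ × IsCylindric c₁ c₂ l₁ l₂ ×
  (size l₁ ℕ.+ size l₂ ≡ N)

isCP? : ∀ c₁ c₂ n N p → Dec (IsCP c₁ c₂ n N p)
isCP? c₁ c₂ n N (l₁ , l₂) =
  all? (λ i → part l₁ (suc (toℕ i)) ≤? part l₁ (toℕ i)) ×-dec
  all? (λ i → part l₂ (suc (toℕ i)) ≤? part l₂ (toℕ i)) ×-dec
  (all? (λ i → part l₂ (toℕ i ℕ.+ c₂) ≤? part l₁ (toℕ i)) ×-dec
   all? (λ i → part l₁ (toℕ i ℕ.+ c₁) ≤? part l₂ (toℕ i))) ×-dec
  (size l₁ ℕ.+ size l₂ ≟ N)

allVecs : (n N : ℕ) → List (Vec ℕ n)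
allVecs zero    N = [] ∷ []
allVecs (suc n) N = concatMap (λ x → map (x ∷_) (allVecs n N)) (upTo (suc N))

allPairs : (n N : ℕ) → List (Vec ℕ n × Vec ℕ n)
allPairs n N = concatMap (λ a → map (a ,_) (allVecs n N)) (allVecs n N)

-- number of cylindric partitions of profile (c1,c2) with at most n parts each, of size N
-- (every part of such an object is ≤ N, so the enumeration is exhaustive)
cpCount : (c₁ c₂ n N : ℕ) → ℕ
cpCount c₁ c₂ n N = length (filter (isCP? c₁ c₂ n N) (allPairs n N))

CP : (c₁ c₂ n : ℕ) → FPS
CP c₁ c₂ n N = + cpCount c₁ c₂ n N

{-# OPTIONS --safe #-}
module Submission where

-- A cylindric partition of profile (c₁, c₂) is a multichain of columns (a, b), the numbers of parts
-- ≥ 1, ≥ 2, … in the two partitions, all lying in the strip −c₂ ≤ a − b ≤ c₁.  Let F(a, b) count those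
-- with at most a and b parts.  Removing the largest column and inclusion–exclusion give
--   (1 − q^(a+b)) F(a,b) = F(a−1,b) + F(a,b−1) − F(a−1,b−1),
-- together with F(a,b−1) = F(a−1,b−1) on the wall a − b = c₁ and F(a−1,b) = F(a−1,b−1) on the wall
-- a − b = −c₂.  Without walls the solution is 1/((q)_a (q)_b), and every translate
-- 1/((q)_(a−s) (q)_(b+s)) solves the same recurrence.  A q-analogue of the reflection principle selects
-- the combination of translates X(a,b) that satisfies both wall conditions, namely, with K = c₁ + c₂ + 2,
--   Σ_k q^(k(2Kk+c₁−c₂)) / ((q)_(a+Kk) (q)_(b−Kk))
--     − Σ_k q^((2k+1)(Kk+c₁+1)) / ((q)_(a−Kk−c₁−1) (q)_(b+Kk+c₁+1)),
-- and at a = b = n its two sums are the even and odd r of the theorem.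

-- The wall conditions come from cancellation between the two sums. Lowering an index x splits
-- `1/(q)_x` into `1/(q)_(x-1)` and a boundary term `q^x/(q)_x`. One step outside the strip, where a
-- - b = c₁ + 1, the k-th terms of the two sums carry the same indices in exchanged order; where b -
-- a = c₂ + 1, the k-th term of the first and the (k-1)-st of the second do. Their boundary terms
-- then differ only by a power of q, and equating the powers gives e₁(k) = e₀(k) + 2Kk + c₁ + 1 and
-- e₀(k) = e₁(k-1) + 2Kk - c₂ - 1. Together with e₀(0) = 0 this determines both quadratic exponents.
-- K is the distance, measured by a - b, between these two lines.
--
-- The recurrence says nothing at a = b = 0, where 1 - q^(a+b) vanishes, so that value is computed
-- directly. The sums vanish at index -1 only near the strip, so counts and sums are compared only
-- on the strip, and a neighbour outside it is traded for the diagonal one by a wall condition.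
--
-- Bilateral sums are truncated at |r| ≤ N in coefficient N, so rearranging them depends on lower
-- bounds for the exponents.

open import Defs
open import Algebra.Bundles using (CommutativeSemiring)
open import Data.Bool using (true; false)
open import Data.Empty using (⊥)
open import Data.Fin using (Fin; toℕ; fromℕ<)
import Data.Fin.Properties as FinP
open import Data.Integer as ℤ using (ℤ; +_; -[1+_]; 0ℤ; 1ℤ; -1ℤ; ∣_∣; _/ℕ_)
import Data.Integer.Properties as ℤP
import Data.Integer.Tactic.RingSolver as ℤSolver
open import Data.List using (List; []; _∷_; map; concatMap; filter; length; upTo; cartesianProductWith; _++_)
open import Data.List.Membership.Propositional using (_∈_)
open import Data.List.Membership.Propositional.Properties
  using (∈-map⁺; ∈-map⁻; ∈-filter⁺; ∈-filter⁻; ∈-upTo⁺; ∈-cartesianProductWith⁺)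
open import Data.List.Membership.Propositional.Properties.WithK using (unique∧set⇒bag)
import Data.List.Properties as ListP
open import Data.List.Relation.Binary.BagAndSetEquality using (∼bag⇒↭)
open import Data.List.Relation.Binary.Permutation.Propositional.Properties using (↭-length)
import Data.List.Relation.Unary.All as All
open import Data.List.Relation.Unary.AllPairs using ([]; _∷_)
open import Data.List.Relation.Unary.Any using (here)
open import Data.List.Relation.Unary.Unique.Propositional using (Unique)
import Data.List.Relation.Unary.Unique.Propositional.Properties as Unique
open import Data.Nat as ℕ using (ℕ; zero; suc; z≤n; s≤s)
open import Data.Nat.Divisibility using (_∣_; _∣?_; _∣0; ∣⇒≤; ∣m+n∣m⇒∣n; ∣m∣n⇒∣m+n; ∣-refl)
import Data.Nat.DivMod as DivMod
import Data.Nat.Properties as ℕP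
import Data.Nat.Tactic.RingSolver as ℕSolver
open import Data.Product using (_×_; _,_; proj₁; proj₂; ∃)
open import Data.Sum using (_⊎_; inj₁; inj₂)
open import Data.Vec using (Vec; []; _∷_; replicate)
import Data.Vec.Properties as VecP
open import Function using (_∘_; id; mk⇔)
open import Level using (0ℓ)
open import Relation.Binary.PropositionalEquality
  using (_≡_; _≢_; refl; sym; trans; cong; cong₂; subst; subst₂; module ≡-Reasoning)
open import Relation.Nullary using (Dec; yes; no; does; ¬_; ¬?; _×-dec_; contradiction)
open import Relation.Unary using (Decidable)
open import Algebra.Properties.AbelianGroup ℤP.+-0-abelianGroup using (∙-cancelʳ)

open ≡-Reasoning

-- Formal power series

sumTo-cong : ∀ m {f g : ℕ → ℤ} → (∀ i → i ℕ.< m → f i ≡ g i) → sumTo m f ≡ sumTo m g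
sumTo-cong zero    f≡g = refl
sumTo-cong (suc m) f≡g =
  cong₂ ℤ._+_ (sumTo-cong m λ i i<m → f≡g i (ℕP.m<n⇒m<1+n i<m)) (f≡g m (ℕP.n<1+n m))

sumTo-zero : ∀ m {f : ℕ → ℤ} → (∀ i → i ℕ.< m → f i ≡ 0ℤ) → sumTo m f ≡ 0ℤ
sumTo-zero zero    f≡0 = refl
sumTo-zero (suc m) f≡0 =
  cong₂ ℤ._+_ (sumTo-zero m λ i i<m → f≡0 i (ℕP.m<n⇒m<1+n i<m)) (f≡0 m (ℕP.n<1+n m))

sumTo-front : ∀ m (f : ℕ → ℤ) → sumTo (suc m) f ≡ f 0 ℤ.+ sumTo m (f ∘ suc)
sumTo-front zero    f = ℤP.+-comm 0ℤ (f 0)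
sumTo-front (suc m) f =
  trans (cong (ℤ._+ f (suc m)) (sumTo-front m f)) (ℤP.+-assoc (f 0) _ _)

+-interchange : ∀ w x y z → (w ℤ.+ x) ℤ.+ (y ℤ.+ z) ≡ (w ℤ.+ y) ℤ.+ (x ℤ.+ z)
+-interchange = ℤSolver.solve-∀

sumTo-+ : ∀ m (f g : ℕ → ℤ) → sumTo m (λ i → f i ℤ.+ g i) ≡ sumTo m f ℤ.+ sumTo m g
sumTo-+ zero    f g = refl
sumTo-+ (suc m) f g =
  trans (cong (ℤ._+ (f m ℤ.+ g m)) (sumTo-+ m f g)) (+-interchange (sumTo m f) _ _ _)

sumTo-* : ∀ m c (f : ℕ → ℤ) → sumTo m (λ i → c ℤ.* f i) ≡ c ℤ.* sumTo m f
sumTo-* zero    c f = sym (ℤP.*-zeroʳ c)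
sumTo-* (suc m) c f =
  trans (cong (ℤ._+ c ℤ.* f m) (sumTo-* m c f)) (sym (ℤP.*-distribˡ-+ c _ _))

sumTo-swap : ∀ m k (f : ℕ → ℕ → ℤ) →
  sumTo m (λ i → sumTo k (f i)) ≡ sumTo k (λ j → sumTo m (λ i → f i j))
sumTo-swap zero    k f = sym (sumTo-zero k λ _ _ → refl)
sumTo-swap (suc m) k f =
  trans (cong (ℤ._+ sumTo k (f m)) (sumTo-swap m k f)) (sym (sumTo-+ k _ _))

infix 4 _≈_
infixl 6 _⊕_

-- A record rather than a function type, so that Agda can infer the two series from a proof.
record _≈_ (f g : FPS) : Set where
  constructor coeffwise
  field at : ∀ N → f N ≡ g N

open _≈_ public

_⊕_ : FPS → FPS → FPS
(f ⊕ g) N = f N ℤ.+ g N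

scale : ℤ → FPS → FPS
scale c f N = c ℤ.* f N

≈-refl : ∀ {f} → f ≈ f
≈-refl .at N = refl

≈-sym : ∀ {f g} → f ≈ g → g ≈ f
≈-sym f≈g .at N = sym (f≈g .at N)

≈-trans : ∀ {f g h} → f ≈ g → g ≈ h → f ≈ h
≈-trans f≈g g≈h .at N = trans (f≈g .at N) (g≈h .at N)

⊕-cong : ∀ {f f′ g g′} → f ≈ f′ → g ≈ g′ → f ⊕ g ≈ f′ ⊕ g′
⊕-cong p q .at N = cong₂ ℤ._+_ (p .at N) (q .at N)

⊕-congˡ : ∀ h {f g} → f ≈ g → h ⊕ f ≈ h ⊕ g
⊕-congˡ h = ⊕-cong {h} ≈-refl

⊕-cancelʳ : ∀ {f g} h → f ⊕ h ≈ g ⊕ h → f ≈ g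
⊕-cancelʳ {f} {g} h eq .at N = ∙-cancelʳ (h N) (f N) (g N) (eq .at N)

⊛-cong : ∀ {f f′ g g′} → f ≈ f′ → g ≈ g′ → f ⊛ g ≈ f′ ⊛ g′
⊛-cong p q .at N = sumTo-cong (suc N) λ i _ → cong₂ ℤ._*_ (p .at i) (q .at (N ℕ.∸ i))

⊛-congˡ : ∀ h {f g} → f ≈ g → h ⊛ f ≈ h ⊛ g
⊛-congˡ h = ⊛-cong {h} ≈-refl

⊛-congʳ : ∀ h {f g} → f ≈ g → f ⊛ h ≈ g ⊛ h
⊛-congʳ h f≈g = ⊛-cong {g = h} f≈g ≈-refl

⊛-suc : ∀ f g N → (f ⊛ g) (suc N) ≡ f 0 ℤ.* g (suc N) ℤ.+ ((f ∘ suc) ⊛ g) N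
⊛-suc f g N = sumTo-front (suc N) _

⊛-sucʳ : ∀ f g N → (f ⊛ g) (suc N) ≡ (f ⊛ (g ∘ suc)) N ℤ.+ f (suc N) ℤ.* g 0
⊛-sucʳ f g N = cong₂ ℤ._+_
  (sumTo-cong (suc N) λ i i≤N → cong (λ j → f i ℤ.* g j) (ℕP.+-∸-assoc 1 (ℕP.≤-pred i≤N)))
  (cong (λ j → f (suc N) ℤ.* g j) (ℕP.n∸n≡0 N))

-- Peeling the first term off one product and the last term off the other leaves the same claim at
-- `N` for the tail of `f`.
⊛-comm : ∀ f g → f ⊛ g ≈ g ⊛ f
⊛-comm f g .at zero    = cong (ℤ._+_ 0ℤ) (ℤP.*-comm (f 0) (g 0))
⊛-comm f g .at (suc N) = begin
  (f ⊛ g) (suc N)                                ≡⟨ ⊛-suc f g N ⟩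
  f 0 ℤ.* g (suc N) ℤ.+ ((f ∘ suc) ⊛ g) N         ≡⟨ ℤP.+-comm (f 0 ℤ.* g (suc N)) _ ⟩
  ((f ∘ suc) ⊛ g) N ℤ.+ f 0 ℤ.* g (suc N)         ≡⟨ cong₂ ℤ._+_ (⊛-comm (f ∘ suc) g .at N) (ℤP.*-comm (f 0) _) ⟩
  (g ⊛ (f ∘ suc)) N ℤ.+ g (suc N) ℤ.* f 0         ≡⟨ ⊛-sucʳ g f N ⟨
  (g ⊛ f) (suc N)                                ∎

⊛-distribˡ : ∀ f g h → f ⊛ (g ⊕ h) ≈ f ⊛ g ⊕ f ⊛ h
⊛-distribˡ f g h .at N = trans
  (sumTo-cong (suc N) λ i _ → ℤP.*-distribˡ-+ (f i) _ _)
  (sumTo-+ (suc N) _ _)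

⊛-distribʳ : ∀ f g h → (g ⊕ h) ⊛ f ≈ g ⊛ f ⊕ h ⊛ f
⊛-distribʳ f g h .at N = trans
  (sumTo-cong (suc N) λ i _ → ℤP.*-distribʳ-+ _ (g i) (h i))
  (sumTo-+ (suc N) _ _)

scale-⊛ : ∀ c f g → scale c f ⊛ g ≈ scale c (f ⊛ g)
scale-⊛ c f g .at N = trans
  (sumTo-cong (suc N) λ i _ → ℤP.*-assoc c (f i) _)
  (sumTo-* (suc N) c _)

-- The tail of `f ⊛ g` is `f 0` times the tail of `g`, plus the tail of `f` times `g`; this reduces
-- coefficient `suc N` to associativity at `N` for the tail of `f`.
⊛-assoc : ∀ f g h → (f ⊛ g) ⊛ h ≈ f ⊛ (g ⊛ h)
⊛-assoc f g h .at zero    = lemma (f 0) (g 0) (h 0)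
  where
  lemma : ∀ x y z → 0ℤ ℤ.+ (0ℤ ℤ.+ x ℤ.* y) ℤ.* z ≡ 0ℤ ℤ.+ x ℤ.* (0ℤ ℤ.+ y ℤ.* z)
  lemma = ℤSolver.solve-∀
⊛-assoc f g h .at (suc N) = begin
  ((f ⊛ g) ⊛ h) (suc N)
    ≡⟨ ⊛-suc (f ⊛ g) h N ⟩
  (0ℤ ℤ.+ f 0 ℤ.* g 0) ℤ.* h (suc N) ℤ.+ (((f ⊛ g) ∘ suc) ⊛ h) N
    ≡⟨ cong (ℤ._+_ ((0ℤ ℤ.+ f 0 ℤ.* g 0) ℤ.* h (suc N)))
         (⊛-congʳ h (coeffwise {g = scale (f 0) (g ∘ suc) ⊕ (f ∘ suc) ⊛ g} (⊛-suc f g)) .at N) ⟩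
  (0ℤ ℤ.+ f 0 ℤ.* g 0) ℤ.* h (suc N) ℤ.+ ((scale (f 0) (g ∘ suc) ⊕ (f ∘ suc) ⊛ g) ⊛ h) N
    ≡⟨ cong (ℤ._+_ ((0ℤ ℤ.+ f 0 ℤ.* g 0) ℤ.* h (suc N))) (⊛-distribʳ h (scale (f 0) (g ∘ suc)) ((f ∘ suc) ⊛ g) .at N) ⟩
  (0ℤ ℤ.+ f 0 ℤ.* g 0) ℤ.* h (suc N) ℤ.+
    ((scale (f 0) (g ∘ suc) ⊛ h) N ℤ.+ (((f ∘ suc) ⊛ g) ⊛ h) N)
    ≡⟨ cong (ℤ._+_ ((0ℤ ℤ.+ f 0 ℤ.* g 0) ℤ.* h (suc N)))
         (cong₂ ℤ._+_ (scale-⊛ (f 0) (g ∘ suc) h .at N) (⊛-assoc (f ∘ suc) g h .at N)) ⟩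
  (0ℤ ℤ.+ f 0 ℤ.* g 0) ℤ.* h (suc N) ℤ.+
    (f 0 ℤ.* ((g ∘ suc) ⊛ h) N ℤ.+ ((f ∘ suc) ⊛ (g ⊛ h)) N)
    ≡⟨ lemma (f 0) (g 0) (h (suc N)) _ _ ⟩
  f 0 ℤ.* (g 0 ℤ.* h (suc N) ℤ.+ ((g ∘ suc) ⊛ h) N) ℤ.+ ((f ∘ suc) ⊛ (g ⊛ h)) N
    ≡⟨ cong (λ x → f 0 ℤ.* x ℤ.+ ((f ∘ suc) ⊛ (g ⊛ h)) N) (⊛-suc g h N) ⟨
  f 0 ℤ.* (g ⊛ h) (suc N) ℤ.+ ((f ∘ suc) ⊛ (g ⊛ h)) N
    ≡⟨ ⊛-suc f (g ⊛ h) N ⟨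
  (f ⊛ (g ⊛ h)) (suc N) ∎
  where
  lemma : ∀ x y z u v →
    (0ℤ ℤ.+ x ℤ.* y) ℤ.* z ℤ.+ (x ℤ.* u ℤ.+ v) ≡ x ℤ.* (y ℤ.* z ℤ.+ u) ℤ.+ v
  lemma = ℤSolver.solve-∀

zeroS-⊛ : ∀ f → zeroS ⊛ f ≈ zeroS
zeroS-⊛ f .at N = sumTo-zero (suc N) λ i _ → ℤP.*-zeroˡ (f (N ℕ.∸ i))

⊛-zeroS : ∀ f → f ⊛ zeroS ≈ zeroS
⊛-zeroS f = ≈-trans (⊛-comm f zeroS) (zeroS-⊛ f)

oneS-⊛ : ∀ f → oneS ⊛ f ≈ f
oneS-⊛ f .at zero    = trans (ℤP.+-identityˡ _) (ℤP.*-identityˡ (f 0))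
oneS-⊛ f .at (suc N) = begin
  (oneS ⊛ f) (suc N)                       ≡⟨ ⊛-suc oneS f N ⟩
  1ℤ ℤ.* f (suc N) ℤ.+ (zeroS ⊛ f) N        ≡⟨ cong₂ ℤ._+_ (ℤP.*-identityˡ (f (suc N))) (zeroS-⊛ f .at N) ⟩
  f (suc N) ℤ.+ 0ℤ                         ≡⟨ ℤP.+-identityʳ _ ⟩
  f (suc N)                                ∎

⊛-oneS : ∀ f → f ⊛ oneS ≈ f
⊛-oneS f = ≈-trans (⊛-comm f oneS) (oneS-⊛ f)

FPS-commutativeSemiring : CommutativeSemiring 0ℓ 0ℓ
FPS-commutativeSemiring = record
  { Carrier = FPS ; _≈_ = _≈_ ; _+_ = _⊕_ ; _*_ = _⊛_ ; 0# = zeroS ; 1# = oneS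
  ; isCommutativeSemiring = record
    { isSemiring = record
      { isSemiringWithoutAnnihilatingZero = record
        { +-isCommutativeMonoid = record
          { isMonoid = record
            { isSemigroup = record
              { isMagma = record
                { isEquivalence = record { refl = ≈-refl ; sym = ≈-sym ; trans = ≈-trans }
                ; ∙-cong = ⊕-cong }
              ; assoc = λ f g h → coeffwise λ N → ℤP.+-assoc (f N) (g N) (h N) }
            ; identity = (λ f → coeffwise λ N → ℤP.+-identityˡ (f N)) , (λ f → coeffwise λ N → ℤP.+-identityʳ (f N)) }
          ; comm = λ f g → coeffwise λ N → ℤP.+-comm (f N) (g N) }
        ; *-cong = ⊛-cong
        ; *-assoc = ⊛-assoc
        ; *-identity = oneS-⊛ , ⊛-oneS
        ; distrib = ⊛-distribˡ , ⊛-distribʳ }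
      ; zero = zeroS-⊛ , ⊛-zeroS }
    ; *-comm = ⊛-comm } }

module Solver where
  open import Algebra.Solver.Ring.NaturalCoefficients.Default FPS-commutativeSemiring public

open Solver using (_:=_; _:+_; _:*_)

-- Monomials, geometric series and reciprocals of `(q;q)_m`

mono-diag : ∀ m → mono (+ m) m ≡ 1ℤ
mono-diag m with + m ℤ.≟ + m
... | yes _  = refl
... | no m≢m = contradiction refl m≢m

mono-off : ∀ {m N} → N ≢ m → mono (+ m) N ≡ 0ℤ
mono-off {m} {N} N≢m with + N ℤ.≟ + m
... | yes N≡m = contradiction (ℤP.+-injective N≡m) N≢m
... | no _    = refl

mono-0 : mono (+ 0) ≈ oneS
mono-0 .at zero    = mono-diag 0
mono-0 .at (suc N) = mono-off {0} {suc N} λ ()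

mono-suc : ∀ m N → mono (+ suc m) (suc N) ≡ mono (+ m) N
mono-suc m N = by-cases (N ℕP.≟ m)
  where
  by-cases : Dec (N ≡ m) → mono (+ suc m) (suc N) ≡ mono (+ m) N
  by-cases (yes refl) = trans (mono-diag (suc m)) (sym (mono-diag m))
  by-cases (no N≢m)   = trans (mono-off (N≢m ∘ ℕP.suc-injective)) (sym (mono-off N≢m))

-- Multiplication by `q^m` (see `mono-⊛`). The recursive form makes visible which coefficients of
-- `f` are read, as the uniqueness argument for the recurrence requires.
shift : ℕ → FPS → FPS
shift zero    f N       = f N
shift (suc m) f zero    = 0ℤ
shift (suc m) f (suc N) = shift m f N

shift-< : ∀ m f {N} → N ℕ.< m → shift m f N ≡ 0ℤ
shift-< (suc m) f {zero}  _   = refl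
shift-< (suc m) f {suc N} N<m = shift-< m f (ℕ.s<s⁻¹ N<m)

shift-+ : ∀ m f N → shift m f (m ℕ.+ N) ≡ f N
shift-+ zero    f N = refl
shift-+ (suc m) f N = shift-+ m f N

mono-⊛ : ∀ m f → mono (+ m) ⊛ f ≈ shift m f
mono-⊛ zero    f .at N       = trans (⊛-congʳ f mono-0 .at N) (oneS-⊛ f .at N)
mono-⊛ (suc m) f .at zero    = trans (ℤP.+-identityˡ _) (trans
  (cong (ℤ._* f 0) (mono-off {suc m} {0} λ ())) (ℤP.*-zeroˡ (f 0)))
mono-⊛ (suc m) f .at (suc N) = begin
  (mono (+ suc m) ⊛ f) (suc N)                                ≡⟨ ⊛-suc (mono (+ suc m)) f N ⟩
  mono (+ suc m) 0 ℤ.* f (suc N) ℤ.+ ((mono (+ suc m) ∘ suc) ⊛ f) N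
    ≡⟨ cong₂ ℤ._+_ (trans (cong (ℤ._* f (suc N)) (mono-off {suc m} {0} λ ())) (ℤP.*-zeroˡ (f (suc N))))
                   (⊛-congʳ f (coeffwise {g = mono (+ m)} (mono-suc m)) .at N) ⟩
  0ℤ ℤ.+ (mono (+ m) ⊛ f) N                                    ≡⟨ ℤP.+-identityˡ _ ⟩
  (mono (+ m) ⊛ f) N                                          ≡⟨ mono-⊛ m f .at N ⟩
  shift m f N                                                 ∎

shift-mono : ∀ m k → shift m (mono (+ k)) ≈ mono (+ (m ℕ.+ k))
shift-mono zero    k .at N       = refl
shift-mono (suc m) k .at zero    = sym (mono-off {suc (m ℕ.+ k)} {0} λ ())
shift-mono (suc m) k .at (suc N) = trans (shift-mono m k .at N) (sym (mono-suc (m ℕ.+ k) N))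

mono-+ : ∀ m k → mono (+ m) ⊛ mono (+ k) ≈ mono (+ (m ℕ.+ k))
mono-+ m k = ≈-trans (mono-⊛ m (mono (+ k))) (shift-mono m k)

-- This is 1/(1-z) = 1 + z/(1-z) at z = q^(k+1): divisibility by k+1 is unchanged by subtracting
-- k+1, and below k+1 only 0 is divisible.
geomInv-rec : ∀ k → geomInv k ≈ oneS ⊕ mono (+ suc k) ⊛ geomInv k
geomInv-rec k .at N = trans (shift-rec N) (cong (ℤ._+_ (oneS N)) (sym (mono-⊛ (suc k) (geomInv k) .at N)))
  where
  geomInv-∣ : ∀ {N} → suc k ∣ N → geomInv k N ≡ 1ℤ
  geomInv-∣ {N} k∣N with suc k ∣? N
  ... | yes _  = refl
  ... | no k∤N = contradiction k∣N k∤N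

  geomInv-step : ∀ N → geomInv k (suc k ℕ.+ N) ≡ geomInv k N
  geomInv-step N with suc k ∣? N
  ... | yes k∣N = geomInv-∣ (∣m∣n⇒∣m+n ∣-refl k∣N)
  ... | no k∤N with suc k ∣? suc k ℕ.+ N
  ...   | yes k∣k+N = contradiction (∣m+n∣m⇒∣n k∣k+N ∣-refl) k∤N
  ...   | no _      = refl

  geomInv-small : ∀ N → N ℕ.< k → geomInv k (suc N) ≡ 0ℤ
  geomInv-small N N<k with suc k ∣? suc N
  ... | yes k∣N = contradiction (∣⇒≤ k∣N) (ℕP.<⇒≱ (ℕ.s<s N<k))
  ... | no _    = refl

  shift-rec : ∀ N → geomInv k N ≡ oneS N ℤ.+ shift (suc k) (geomInv k) N
  shift-rec zero    = geomInv-∣ (suc k ∣0)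
  shift-rec (suc N) with ℕP.<-≤-connex N k
  ... | inj₁ N<k = trans (geomInv-small N N<k)
                         (sym (trans (ℤP.+-identityˡ _) (shift-< k (geomInv k) N<k)))
  ... | inj₂ k≤N with ℕP.m≤n⇒∃[o]m+o≡n k≤N
  ...   | o , refl = trans (geomInv-step o)
                           (sym (trans (ℤP.+-identityˡ _) (shift-+ k (geomInv k) o)))

oneMinusQ-geomInv : ∀ k → oneMinusQ (suc k) ⊛ geomInv k ≈ oneS
-- Series are handled as a semiring, so the subtracted monomial is moved to the other side, where
-- `geomInv-rec` applies.
oneMinusQ-geomInv k = ⊕-cancelʳ (mono (+ suc k) ⊛ geomInv k) (≈-trans
  (≈-sym (⊛-distribʳ (geomInv k) (oneMinusQ (suc k)) (mono (+ suc k))))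
  (≈-trans (⊛-congʳ (geomInv k) (coeffwise {g = oneS} λ N → lemma (oneS N) (mono (+ suc k) N)))
  (≈-trans (oneS-⊛ (geomInv k)) (geomInv-rec k))))
  where
  lemma : ∀ x y → (x ℤ.- y) ℤ.+ y ≡ x
  lemma = ℤSolver.solve-∀

qPoch-qPochInv : ∀ m → qPoch m ⊛ qPochInv m ≈ oneS
qPoch-qPochInv zero    = oneS-⊛ oneS
qPoch-qPochInv (suc m) = ≈-trans
  (Solver.solve 4 (λ a b c d → (a :* b) :* (c :* d) := (a :* c) :* (b :* d)) ≈-refl
    (qPoch m) (oneMinusQ (suc m)) (qPochInv m) (geomInv m))
  (≈-trans (⊛-cong (qPoch-qPochInv m) (oneMinusQ-geomInv m)) (oneS-⊛ oneS))

-- 1/(q;q)_x, extended by 0 to negative x; this makes every identity below hold for all integers.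
invPoch : ℤ → FPS
invPoch (+ m)    = qPochInv m
invPoch -[1+ _ ] = zeroS

-- Rearranged from (1 - q^x)/(q)_x = 1/(q)_(x-1). At x = 0 the left factor vanishes, which is why 0
-- is the right value at negative arguments.
invPoch-rec : ∀ x → invPoch x ≈ invPoch (ℤ.pred x) ⊕ mono x ⊛ invPoch x
invPoch-rec (+ zero) .at N = sym (trans (ℤP.+-identityˡ _)
  (trans (⊛-congʳ oneS mono-0 .at N) (oneS-⊛ oneS .at N)))
invPoch-rec (+ suc m) = ≈-trans
  (⊛-congˡ (qPochInv m) (geomInv-rec m))
  (≈-trans (⊛-distribˡ (qPochInv m) oneS (mono (+ suc m) ⊛ geomInv m))
  (⊕-cong (⊛-oneS (qPochInv m))
    (Solver.solve 3 (λ a b c → a :* (b :* c) := b :* (a :* c)) ≈-refl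
      (qPochInv m) (mono (+ suc m)) (geomInv m))))
invPoch-rec -[1+ m ] .at N = sym (trans (ℤP.+-identityˡ _) (⊛-zeroS (mono -[1+ m ]) .at N))

-- Exponents do not add for negative `x`, where `mono x` is the zero series; there both sides vanish
-- thanks to the factor `invPoch x`.
mono-+-invPoch : ∀ m x → mono (+ m) ⊛ (mono x ⊛ invPoch x) ≈ mono (+ m ℤ.+ x) ⊛ invPoch x
mono-+-invPoch m (+ k) = ≈-trans (≈-sym (⊛-assoc (mono (+ m)) (mono (+ k)) (qPochInv k)))
  (⊛-congʳ (qPochInv k) (mono-+ m k))
mono-+-invPoch m x@(-[1+ _ ]) = ≈-trans
  (⊛-congˡ (mono (+ m)) (⊛-zeroS (mono x)))
  (≈-trans (⊛-zeroS (mono (+ m))) (≈-sym (⊛-zeroS (mono (+ m ℤ.+ x)))))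

invPoch-mono-mono : ∀ x y →
  (mono x ⊛ invPoch x) ⊛ (mono y ⊛ invPoch y) ≈ mono (x ℤ.+ y) ⊛ (invPoch x ⊛ invPoch y)
invPoch-mono-mono (+ m) y = ≈-trans
  (Solver.solve 4 (λ a b c d → (a :* b) :* (c :* d) := b :* (a :* (c :* d))) ≈-refl
    (mono (+ m)) (qPochInv m) (mono y) (invPoch y))
  (≈-trans (⊛-congˡ (qPochInv m) (mono-+-invPoch m y))
  (Solver.solve 3 (λ a b c → a :* (b :* c) := b :* (a :* c)) ≈-refl
    (qPochInv m) (mono (+ m ℤ.+ y)) (invPoch y)))
invPoch-mono-mono x@(-[1+ _ ]) y = ≈-trans
  (⊛-congʳ (mono y ⊛ invPoch y) (⊛-zeroS (mono x)))
  (≈-trans (zeroS-⊛ (mono y ⊛ invPoch y))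
  (≈-sym (≈-trans (⊛-congˡ (mono (x ℤ.+ y)) (zeroS-⊛ (invPoch y))) (⊛-zeroS (mono (x ℤ.+ y))))))

-- With P = P′ + U and Q = Q′ + V this is P Q − U V = P′ Q + P Q′ − P′ Q′.
invPoch-⊛-rec : ∀ x y →
  invPoch (ℤ.pred x) ⊛ invPoch y ⊕ invPoch x ⊛ invPoch (ℤ.pred y)
    ⊕ mono (x ℤ.+ y) ⊛ (invPoch x ⊛ invPoch y)
  ≈ invPoch x ⊛ invPoch y ⊕ invPoch (ℤ.pred x) ⊛ invPoch (ℤ.pred y)
invPoch-⊛-rec x y = ≈-trans
  (⊕-cong (⊕-cong (⊛-congˡ P′ (invPoch-rec y)) (⊛-congʳ Q′ (invPoch-rec x)))
          (≈-sym (invPoch-mono-mono x y)))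
  (≈-trans
    (Solver.solve 4
      (λ P′ U Q′ V → P′ :* (Q′ :+ V) :+ (P′ :+ U) :* Q′ :+ U :* V
                  := (P′ :+ U) :* (Q′ :+ V) :+ P′ :* Q′) ≈-refl P′ U Q′ V)
    (⊕-cong (⊛-cong (≈-sym (invPoch-rec x)) (≈-sym (invPoch-rec y))) ≈-refl))
  where
  P′ = invPoch (ℤ.pred x)
  Q′ = invPoch (ℤ.pred y)
  U = mono x ⊛ invPoch x
  V = mono y ⊛ invPoch y

-- Bilateral sums

-- Under this condition the truncation built into `sumℤ` loses nothing, and any wider window gives
-- the same coefficient.
Supported : (ℤ → FPS) → Set
Supported T = ∀ r N → N ℕ.< ∣ r ∣ → T r N ≡ 0ℤ

window : ℕ → ℕ → (ℤ → ℤ) → ℤ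
window l m g = sumTo m (λ i → g (+ i ℤ.- + l))

suc-sub-suc : ∀ i l → + suc i ℤ.- + suc l ≡ + i ℤ.- + l
suc-sub-suc i l = begin
  + suc i ℤ.- + suc l ≡⟨ ℤP.m-n≡m⊖n (suc i) (suc l) ⟩
  suc i ℤ.⊖ suc l     ≡⟨ ℤP.[1+m]⊖[1+n]≡m⊖n i l ⟩
  i ℤ.⊖ l             ≡⟨ ℤP.m-n≡m⊖n i l ⟨
  + i ℤ.- + l         ∎

window-extendˡ : ∀ l m g → window (suc l) (suc m) g ≡ g -[1+ l ] ℤ.+ window l m g
window-extendˡ l m g = trans (sumTo-front m _)
  (cong (ℤ._+_ (g -[1+ l ])) (sumTo-cong m λ i _ → cong g (suc-sub-suc i l)))

balanced : ℕ → (ℤ → ℤ) → ℤ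
balanced M = window M (suc (2 ℕ.* M))

add-sub : ∀ m l → + (m ℕ.+ l) ℤ.- + l ≡ + m
add-sub m l = trans (cong (ℤ._- + l) (ℤP.pos-+ m l)) (lemma (+ m) (+ l))
  where
  lemma : ∀ x y → (x ℤ.+ y) ℤ.- y ≡ x
  lemma = ℤSolver.solve-∀

last-index : ∀ M → + suc (2 ℕ.* M) ℤ.- + M ≡ + suc M
last-index M = trans (cong (λ m → + suc (M ℕ.+ m) ℤ.- + M) (ℕP.+-identityʳ M)) (add-sub (suc M) M)

balanced-suc : ∀ M g → (∀ r → M ℕ.< ∣ r ∣ → g r ≡ 0ℤ) → balanced (suc M) g ≡ balanced M g
balanced-suc M g g≡0 = begin
  window (suc M) (suc (2 ℕ.* suc M)) g
    ≡⟨ window-extendˡ M (2 ℕ.* suc M) g ⟩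
  g -[1+ M ] ℤ.+ window M (2 ℕ.* suc M) g
    ≡⟨ cong (λ m → g -[1+ M ] ℤ.+ window M m g) (ℕP.*-suc 2 M) ⟩
  g -[1+ M ] ℤ.+ (balanced M g ℤ.+ g (+ suc (2 ℕ.* M) ℤ.- + M))
    ≡⟨ cong₂ (λ x y → x ℤ.+ (balanced M g ℤ.+ y)) (g≡0 -[1+ M ] ℕP.≤-refl)
         (trans (cong g (last-index M)) (g≡0 (+ suc M) ℕP.≤-refl)) ⟩
  0ℤ ℤ.+ (balanced M g ℤ.+ 0ℤ)
    ≡⟨ trans (ℤP.+-identityˡ _) (ℤP.+-identityʳ _) ⟩
  balanced M g ∎

balanced-+ : ∀ d M g → (∀ r → M ℕ.< ∣ r ∣ → g r ≡ 0ℤ) → balanced (d ℕ.+ M) g ≡ balanced M g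
balanced-+ zero    M g g≡0 = refl
balanced-+ (suc d) M g g≡0 = trans
  (balanced-suc (d ℕ.+ M) g λ r d+M<r → g≡0 r (ℕP.≤-<-trans (ℕP.m≤n+m M d) d+M<r))
  (balanced-+ d M g g≡0)

sumℤ-balanced : ∀ {T} → Supported T → ∀ {L N} → N ℕ.≤ L → sumℤ T N ≡ balanced L (λ r → T r N)
sumℤ-balanced {T} supp {L} {N} N≤L = begin
  balanced N (λ r → T r N)              ≡⟨ balanced-+ (L ℕ.∸ N) N _ (λ r → supp r N) ⟨
  balanced (L ℕ.∸ N ℕ.+ N) (λ r → T r N) ≡⟨ cong (λ m → balanced m (λ r → T r N)) (ℕP.m∸n+n≡m N≤L) ⟩
  balanced L (λ r → T r N)              ∎

sumℤ-cong : ∀ {T T′} → (∀ r → T r ≈ T′ r) → sumℤ T ≈ sumℤ T′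
sumℤ-cong eq .at N = sumTo-cong (suc (2 ℕ.* N)) λ i _ → eq (+ i ℤ.- + N) .at N

sumℤ-⊕ : ∀ T T′ → sumℤ (λ r → T r ⊕ T′ r) ≈ sumℤ T ⊕ sumℤ T′
sumℤ-⊕ T T′ .at N = sumTo-+ (suc (2 ℕ.* N)) _ _

sumℤ-scale : ∀ c T → sumℤ (λ r → scale c (T r)) ≈ scale c (sumℤ T)
sumℤ-scale c T .at N = sumTo-* (suc (2 ℕ.* N)) c _

sumℤ-single : ∀ T → (∀ r → 0 ℕ.< ∣ r ∣ → T r ≈ zeroS) → sumℤ T ≈ T 0ℤ
sumℤ-single T T≈0 .at N = begin
  balanced N (λ r → T r N)          ≡⟨ cong (λ m → balanced m (λ r → T r N)) (ℕP.+-identityʳ N) ⟨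
  balanced (N ℕ.+ 0) (λ r → T r N)  ≡⟨ balanced-+ N 0 _ (λ r 0<r → T≈0 r 0<r .at N) ⟩
  0ℤ ℤ.+ T 0ℤ N                     ≡⟨ ℤP.+-identityˡ _ ⟩
  T 0ℤ N                            ∎

sumℤ-zeroS : sumℤ (λ _ → zeroS) ≈ zeroS
sumℤ-zeroS .at N = sumTo-zero (suc (2 ℕ.* N)) λ _ _ → refl

-- Each coefficient `N ∸ i` of `sumℤ T` is truncated to its own window; widening all of them to the
-- window of `N` turns the claim into an exchange of two finite sums.
⊛-sumℤ : ∀ G {T} → Supported T → G ⊛ sumℤ T ≈ sumℤ (λ r → G ⊛ T r)
⊛-sumℤ G {T} supp .at N = begin
  sumTo (suc N) (λ i → G i ℤ.* sumℤ T (N ℕ.∸ i))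
    ≡⟨ sumTo-cong (suc N) (λ i _ → trans
         (cong (ℤ._*_ (G i)) (sumℤ-balanced supp (ℕP.m∸n≤m N i)))
         (sym (sumTo-* (suc (2 ℕ.* N)) (G i) _))) ⟩
  sumTo (suc N) (λ i → balanced N (λ r → G i ℤ.* T r (N ℕ.∸ i)))
    ≡⟨ sumTo-swap (suc N) (suc (2 ℕ.* N)) _ ⟩
  sumℤ (λ r → G ⊛ T r) N ∎

-- The sum of `T r` over -N-1 ≤ r ≤ N is also the sum of `T (r − 1)` over -N ≤ r ≤ N+1. `supp`
-- removes the extra left term of the first reading, `supp′` the extra right term of the second.
sumℤ-pred : ∀ {T} → Supported T → Supported (T ∘ ℤ.pred) → sumℤ T ≈ sumℤ (T ∘ ℤ.pred)
sumℤ-pred {T} supp supp′ .at N = begin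
  window N (suc (2 ℕ.* N)) g
    ≡⟨ ℤP.+-identityˡ _ ⟨
  0ℤ ℤ.+ window N (suc (2 ℕ.* N)) g
    ≡⟨ cong (ℤ._+ window N (suc (2 ℕ.* N)) g) (supp -[1+ N ] N ℕP.≤-refl) ⟨
  g -[1+ N ] ℤ.+ window N (suc (2 ℕ.* N)) g
    ≡⟨ window-extendˡ N (suc (2 ℕ.* N)) g ⟨
  window (suc N) (suc (suc (2 ℕ.* N))) g
    ≡⟨ sumTo-cong (suc (suc (2 ℕ.* N))) (λ i _ → cong g (lemma i)) ⟩
  window N (suc (2 ℕ.* N)) (g ∘ ℤ.pred) ℤ.+ T (ℤ.pred (+ suc (2 ℕ.* N) ℤ.- + N)) N
    ≡⟨ cong (ℤ._+_ (window N (suc (2 ℕ.* N)) (g ∘ ℤ.pred)))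
         (supp′ (+ suc (2 ℕ.* N) ℤ.- + N) N
           (ℕP.≤-reflexive (cong ∣_∣ (sym (last-index N))))) ⟩
  window N (suc (2 ℕ.* N)) (g ∘ ℤ.pred) ℤ.+ 0ℤ
    ≡⟨ ℤP.+-identityʳ _ ⟩
  sumℤ (T ∘ ℤ.pred) N ∎
  where
  g : ℤ → ℤ
  g r = T r N

  lemma : ∀ i → + i ℤ.- + suc N ≡ ℤ.pred (+ i ℤ.- + N)
  lemma i = trans (cong (λ x → + i ℤ.- x) (ℤP.pos-+ 1 N)) (ring (+ i) (+ N))
    where
    ring : ∀ x y → x ℤ.- (1ℤ ℤ.+ y) ≡ ℤ.-1ℤ ℤ.+ (x ℤ.- y)
    ring = ℤSolver.solve-∀

sumTo-pairs : ∀ m h → sumTo (2 ℕ.* m) h ≡ sumTo m (λ i → h (2 ℕ.* i) ℤ.+ h (suc (2 ℕ.* i)))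
sumTo-pairs zero    h = refl
sumTo-pairs (suc m) h = begin
  sumTo (2 ℕ.* suc m) h
    ≡⟨ cong (λ n → sumTo n h) (ℕP.*-suc 2 m) ⟩
  sumTo (2 ℕ.* m) h ℤ.+ h (2 ℕ.* m) ℤ.+ h (suc (2 ℕ.* m))
    ≡⟨ ℤP.+-assoc (sumTo (2 ℕ.* m) h) _ _ ⟩
  sumTo (2 ℕ.* m) h ℤ.+ (h (2 ℕ.* m) ℤ.+ h (suc (2 ℕ.* m)))
    ≡⟨ cong (ℤ._+ (h (2 ℕ.* m) ℤ.+ h (suc (2 ℕ.* m)))) (sumTo-pairs m h) ⟩
  sumTo (suc m) (λ i → h (2 ℕ.* i) ℤ.+ h (suc (2 ℕ.* i))) ∎

-- The window is widened to |r| ≤ 2N and given the vanishing term r = 2N+1. It then has 4N+2 terms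
-- and starts at the even number -2N, so consecutive terms pair up as 2k, 2k+1 with |k| ≤ N.
sumℤ-parity : ∀ {T} → Supported T →
  sumℤ T ≈ sumℤ (λ k → T (+ 2 ℤ.* k) ⊕ T (+ 2 ℤ.* k ℤ.+ 1ℤ))
sumℤ-parity {T} supp .at N = begin
  sumℤ T N
    ≡⟨ sumℤ-balanced supp (ℕP.m≤m+n N (N ℕ.+ 0)) ⟩
  window M (suc (2 ℕ.* M)) g
    ≡⟨ ℤP.+-identityʳ _ ⟨
  window M (suc (2 ℕ.* M)) g ℤ.+ 0ℤ
    ≡⟨ cong (ℤ._+_ (window M (suc (2 ℕ.* M)) g)) (supp (+ suc (2 ℕ.* M) ℤ.- + M) N
         (subst (λ x → N ℕ.< ∣ x ∣) (sym (last-index M)) (ℕ.s≤s (ℕP.m≤m+n N (N ℕ.+ 0))))) ⟨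
  sumTo (suc (suc (2 ℕ.* M))) (λ i → g (+ i ℤ.- + M))
    ≡⟨ cong (λ m → sumTo m (λ i → g (+ i ℤ.- + M))) (ℕP.*-suc 2 M) ⟨
  sumTo (2 ℕ.* suc M) (λ i → g (+ i ℤ.- + M))
    ≡⟨ sumTo-pairs (suc M) _ ⟩
  sumTo (suc M) (λ i → g (+ (2 ℕ.* i) ℤ.- + M) ℤ.+ g (+ suc (2 ℕ.* i) ℤ.- + M))
    ≡⟨ sumTo-cong (suc M) (λ i _ → cong₂ ℤ._+_ (cong g (even i)) (cong g (odd i))) ⟩
  sumℤ (λ k → T (+ 2 ℤ.* k) ⊕ T (+ 2 ℤ.* k ℤ.+ 1ℤ)) N ∎
  where
  M : ℕ
  M = 2 ℕ.* N

  g : ℤ → ℤ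
  g r = T r N

  even : ∀ i → + (2 ℕ.* i) ℤ.- + M ≡ + 2 ℤ.* (+ i ℤ.- + N)
  even i = trans (cong₂ ℤ._-_ (ℤP.pos-* 2 i) (ℤP.pos-* 2 N)) (ring (+ i) (+ N))
    where
    ring : ∀ x y → + 2 ℤ.* x ℤ.- + 2 ℤ.* y ≡ + 2 ℤ.* (x ℤ.- y)
    ring = ℤSolver.solve-∀

  odd : ∀ i → + suc (2 ℕ.* i) ℤ.- + M ≡ + 2 ℤ.* (+ i ℤ.- + N) ℤ.+ 1ℤ
  odd i = begin
    + suc (2 ℕ.* i) ℤ.- + M           ≡⟨ cong (ℤ._- + M) (ℤP.pos-+ 1 (2 ℕ.* i)) ⟩
    (1ℤ ℤ.+ + (2 ℕ.* i)) ℤ.- + M      ≡⟨ ring (+ (2 ℕ.* i)) (+ M) ⟩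
    (+ (2 ℕ.* i) ℤ.- + M) ℤ.+ 1ℤ      ≡⟨ cong (ℤ._+ 1ℤ) (even i) ⟩
    + 2 ℤ.* (+ i ℤ.- + N) ℤ.+ 1ℤ      ∎
    where
    ring : ∀ x y → (1ℤ ℤ.+ x) ℤ.- y ≡ (x ℤ.- y) ℤ.+ 1ℤ
    ring = ℤSolver.solve-∀

-- The reflected sums

-- Nonnegativity with a witness. Inequalities below are proved by a ring identity that brings the
-- expression into a subtraction-free form, whose shape the combinators then follow.
IsNat : ℤ → Set
IsNat x = ∃ λ m → x ≡ + m

pos : ∀ m → IsNat (+ m)
pos m = m , refl

infixl 6 _⟨+⟩_
infixl 7 _⟨*⟩_

_⟨+⟩_ : ∀ {x y} → IsNat x → IsNat y → IsNat (x ℤ.+ y)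
(m , refl) ⟨+⟩ (n , refl) = m ℕ.+ n , refl

_⟨*⟩_ : ∀ {x y} → IsNat x → IsNat y → IsNat (x ℤ.* y)
(m , refl) ⟨*⟩ (n , refl) = m ℕ.* n , sym (ℤP.pos-* m n)

invPoch-neg : ∀ {x} → IsNat (-1ℤ ℤ.- x) → invPoch x ≈ zeroS
invPoch-neg { -[1+ _ ]} _              = ≈-refl
invPoch-neg {+ zero}    (m , ())
invPoch-neg {+ suc _}   (m , ())

invPoch-pair-neg : ∀ f x y → IsNat (-1ℤ ℤ.- x) ⊎ IsNat (-1ℤ ℤ.- y) →
  f ⊛ (invPoch x ⊛ invPoch y) ≈ zeroS
invPoch-pair-neg f x y (inj₁ x<0) = ≈-trans
  (⊛-congˡ f (≈-trans (⊛-congʳ (invPoch y) (invPoch-neg {x} x<0)) (zeroS-⊛ (invPoch y)))) (⊛-zeroS f)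
invPoch-pair-neg f x y (inj₂ y<0) = ≈-trans
  (⊛-congˡ f (≈-trans (⊛-congˡ (invPoch x) (invPoch-neg {y} y<0)) (⊛-zeroS (invPoch x)))) (⊛-zeroS f)

-- The bound on exponents that makes weighted families `Supported`; it also makes every exponent
-- nonnegative, so that `mono` of it is a genuine power of q.
Grows : (ℤ → ℤ) → Set
Grows e = ∀ k → IsNat (e k ℤ.- + ∣ k ∣)

Grows⇒IsNat : ∀ e → Grows e → ∀ k → ∃ λ m → e k ≡ + m × ∣ k ∣ ℕ.≤ m
Grows⇒IsNat e grows k with grows k
... | d , e-k≡d = d ℕ.+ ∣ k ∣ , trans (lemma (e k) (+ ∣ k ∣)) (cong (ℤ._+ + ∣ k ∣) e-k≡d) , ℕP.m≤n+m ∣ k ∣ d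
  where
  lemma : ∀ x y → x ≡ (x ℤ.- y) ℤ.+ y
  lemma = ℤSolver.solve-∀

mono-supported : ∀ e → Grows e → (G : ℤ → FPS) → Supported (λ k → mono (e k) ⊛ G k)
mono-supported e grows G k N N<k with Grows⇒IsNat e grows k
... | m , e≡m , k≤m = trans (cong (λ x → (mono x ⊛ G k) N) e≡m)
  (trans (mono-⊛ m (G k) .at N) (shift-< m (G k) (ℕP.<-≤-trans N<k k≤m)))

≡⇒≈ : ∀ {f g} → f ≡ g → f ≈ g
≡⇒≈ refl = ≈-refl

-- The common shape of both sums. A translate moves `s k` from one index to the other, so a + b, on
-- which alone the coefficient of the recurrence depends, is the same for all terms and `theta-rec`
-- holds term by term.
module Theta (e s : ℤ → ℤ) (grows : Grows e) where

  weighted : ℤ → ℤ → ℤ → FPS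
  weighted a b k = mono (e k) ⊛ (invPoch (a ℤ.- s k) ⊛ invPoch (b ℤ.+ s k))

  theta : ℤ → ℤ → FPS
  theta a b = sumℤ (weighted a b)

  supported : ∀ a b → Supported (weighted a b)
  supported a b = mono-supported e grows (λ k → invPoch (a ℤ.- s k) ⊛ invPoch (b ℤ.+ s k))

  private
    pair : ℤ → ℤ → ℤ → FPS
    pair k x y = mono (e k) ⊛ (invPoch x ⊛ invPoch y)

    predˡ : ∀ a b k → weighted (ℤ.pred a) b k ≈ pair k (ℤ.pred (a ℤ.- s k)) (b ℤ.+ s k)
    predˡ a b k = ≡⇒≈ (cong (λ x → pair k x (b ℤ.+ s k)) (ℤP.+-assoc -1ℤ a (ℤ.- s k)))

    predʳ : ∀ a b k → weighted a (ℤ.pred b) k ≈ pair k (a ℤ.- s k) (ℤ.pred (b ℤ.+ s k))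
    predʳ a b k = ≡⇒≈ (cong (pair k (a ℤ.- s k)) (ℤP.+-assoc -1ℤ b (s k)))

    predˡʳ : ∀ a b k →
      weighted (ℤ.pred a) (ℤ.pred b) k ≈ pair k (ℤ.pred (a ℤ.- s k)) (ℤ.pred (b ℤ.+ s k))
    predˡʳ a b k = ≡⇒≈ (cong₂ (pair k) (ℤP.+-assoc -1ℤ a (ℤ.- s k)) (ℤP.+-assoc -1ℤ b (s k)))

  weighted-zero : ∀ a b k → IsNat (-1ℤ ℤ.- (a ℤ.- s k)) ⊎ IsNat (-1ℤ ℤ.- (b ℤ.+ s k)) →
    weighted a b k ≈ zeroS
  weighted-zero a b k = invPoch-pair-neg (mono (e k)) (a ℤ.- s k) (b ℤ.+ s k)

  theta-zero : ∀ a b → (∀ k → IsNat (-1ℤ ℤ.- (a ℤ.- s k)) ⊎ IsNat (-1ℤ ℤ.- (b ℤ.+ s k))) →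
    theta a b ≈ zeroS
  theta-zero a b neg =
    ≈-trans (sumℤ-cong {weighted a b} {λ _ → zeroS} λ k → weighted-zero a b k (neg k)) sumℤ-zeroS

  theta-rec : ∀ a b → theta (ℤ.pred a) b ⊕ theta a (ℤ.pred b) ⊕ mono (a ℤ.+ b) ⊛ theta a b
                    ≈ theta a b ⊕ theta (ℤ.pred a) (ℤ.pred b)
  theta-rec a b = ≈-trans
    (⊕-cong (≈-sym (sumℤ-⊕ (weighted (ℤ.pred a) b) (weighted a (ℤ.pred b))))
            (⊛-sumℤ (mono (a ℤ.+ b)) (supported a b)))
    (≈-trans (≈-sym (sumℤ-⊕ (λ k → weighted (ℤ.pred a) b k ⊕ weighted a (ℤ.pred b) k) (λ k → mono (a ℤ.+ b) ⊛ weighted a b k)))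
    (≈-trans (sumℤ-cong termwise) (sumℤ-⊕ (weighted a b) (weighted (ℤ.pred a) (ℤ.pred b)))))
    where
    add-sub-cancel : ∀ a b s → (a ℤ.- s) ℤ.+ (b ℤ.+ s) ≡ a ℤ.+ b
    add-sub-cancel = ℤSolver.solve-∀

    termwise : ∀ k →
      weighted (ℤ.pred a) b k ⊕ weighted a (ℤ.pred b) k ⊕ mono (a ℤ.+ b) ⊛ weighted a b k
      ≈ weighted a b k ⊕ weighted (ℤ.pred a) (ℤ.pred b) k
    termwise k = ≈-trans
      (⊕-cong (⊕-cong (predˡ a b k) (predʳ a b k))
              (⊛-congʳ (weighted a b k) (≡⇒≈ (cong mono (sym (add-sub-cancel a b (s k)))))))
      (≈-trans
        (Solver.solve 5 (λ q A B c D → q :* A :+ q :* B :+ c :* (q :* D) := q :* (A :+ B :+ c :* D))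
          ≈-refl (mono (e k)) (invPoch (ℤ.pred x) ⊛ invPoch y) (invPoch x ⊛ invPoch (ℤ.pred y))
          (mono (x ℤ.+ y)) (invPoch x ⊛ invPoch y))
      (≈-trans (⊛-congˡ (mono (e k)) (invPoch-⊛-rec x y))
      (≈-trans (⊛-distribˡ (mono (e k)) (invPoch x ⊛ invPoch y) (invPoch (ℤ.pred x) ⊛ invPoch (ℤ.pred y)))
      (⊕-cong (≈-refl {weighted a b k}) (≈-sym (predˡʳ a b k))))))
      where
      x y : ℤ
      x = a ℤ.- s k
      y = b ℤ.+ s k

  -- The parts split off by `invPoch-rec` when `a`, respectively `b`, is lowered. The lowered index
  -- comes first in both, which is the order that `boundary-swap` expects.
  boundaryˡ boundaryʳ : ℤ → ℤ → ℤ → FPS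
  boundaryˡ a b k = mono (e k) ⊛ ((mono (a ℤ.- s k) ⊛ invPoch (a ℤ.- s k)) ⊛ invPoch (b ℤ.+ s k))
  boundaryʳ a b k = mono (e k) ⊛ ((mono (b ℤ.+ s k) ⊛ invPoch (b ℤ.+ s k)) ⊛ invPoch (a ℤ.- s k))

  theta-predˡ : ∀ a b → theta a b ≈ theta (ℤ.pred a) b ⊕ sumℤ (boundaryˡ a b)
  theta-predˡ a b = ≈-trans (sumℤ-cong termwise) (sumℤ-⊕ (weighted (ℤ.pred a) b) (boundaryˡ a b))
    where
    termwise : ∀ k → weighted a b k ≈ weighted (ℤ.pred a) b k ⊕ boundaryˡ a b k
    termwise k = ≈-trans
      (⊛-congˡ (mono (e k)) (⊛-congʳ (invPoch y) (invPoch-rec x)))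
      (≈-trans
        (Solver.solve 4 (λ q A B C → q :* ((A :+ B) :* C) := q :* (A :* C) :+ q :* (B :* C))
          ≈-refl (mono (e k)) (invPoch (ℤ.pred x)) (mono x ⊛ invPoch x) (invPoch y))
      (⊕-cong (≈-sym (predˡ a b k)) (≈-refl {boundaryˡ a b k})))
      where
      x y : ℤ
      x = a ℤ.- s k
      y = b ℤ.+ s k

  theta-predʳ : ∀ a b → theta a b ≈ theta a (ℤ.pred b) ⊕ sumℤ (boundaryʳ a b)
  theta-predʳ a b = ≈-trans (sumℤ-cong termwise) (sumℤ-⊕ (weighted a (ℤ.pred b)) (boundaryʳ a b))
    where
    termwise : ∀ k → weighted a b k ≈ weighted a (ℤ.pred b) k ⊕ boundaryʳ a b k
    termwise k = ≈-trans
      (⊛-congˡ (mono (e k)) (⊛-congˡ (invPoch x) (invPoch-rec y)))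
      (≈-trans
        (Solver.solve 4 (λ q A B C → q :* (C :* (A :+ B)) := q :* (C :* A) :+ q :* (B :* C))
          ≈-refl (mono (e k)) (invPoch (ℤ.pred y)) (mono y ⊛ invPoch y) (invPoch x))
      (⊕-cong (≈-sym (predʳ a b k)) (≈-refl {boundaryʳ a b k})))
      where
      x y : ℤ
      x = a ℤ.- s k
      y = b ℤ.+ s k

-- The reflection step: both sides are one power of q times 1/((q)_x (q)_y), and this product is
-- symmetric in x and y.
boundary-swap : ∀ {u v x y} → IsNat u → IsNat v → u ℤ.+ x ≡ v ℤ.+ y →
  mono u ⊛ ((mono x ⊛ invPoch x) ⊛ invPoch y) ≈ mono v ⊛ ((mono y ⊛ invPoch y) ⊛ invPoch x)
boundary-swap {x = x} {y} (m , refl) (n , refl) eq = ≈-trans (combine m x y)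
  (≈-trans (⊛-congʳ (invPoch x ⊛ invPoch y) (≡⇒≈ (cong mono eq)))
  (≈-trans (⊛-congˡ (mono (+ n ℤ.+ y)) (⊛-comm (invPoch x) (invPoch y)))
  (≈-sym (combine n y x))))
  where
  combine : ∀ m x y → mono (+ m) ⊛ ((mono x ⊛ invPoch x) ⊛ invPoch y)
                    ≈ mono (+ m ℤ.+ x) ⊛ (invPoch x ⊛ invPoch y)
  combine m x y = ≈-trans (≈-sym (⊛-assoc (mono (+ m)) (mono x ⊛ invPoch x) (invPoch y)))
    (≈-trans (⊛-congʳ (invPoch y) (mono-+-invPoch m x))
    (⊛-assoc (mono (+ m ℤ.+ x)) (invPoch x) (invPoch y)))

infixl 6 _⊖_

_⊖_ : FPS → FPS → FPS
(f ⊖ g) N = f N ℤ.- g N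

⊖-cong : ∀ {f f′ g g′} → f ≈ f′ → g ≈ g′ → f ⊖ g ≈ f′ ⊖ g′
⊖-cong p q .at N = cong₂ ℤ._-_ (p .at N) (q .at N)

⊖-⊕ : ∀ f f′ g g′ → (f ⊖ f′) ⊕ (g ⊖ g′) ≈ (f ⊕ g) ⊖ (f′ ⊕ g′)
⊖-⊕ f f′ g g′ .at N = ring (f N) (f′ N) (g N) (g′ N)
  where
  ring : ∀ u u′ v v′ → (u ℤ.- u′) ℤ.+ (v ℤ.- v′) ≡ (u ℤ.+ v) ℤ.- (u′ ℤ.+ v′)
  ring = ℤSolver.solve-∀

⊖-cancel : ∀ {f f′} u u′ v → f ≈ u ⊕ v → f′ ≈ u′ ⊕ v → f ⊖ f′ ≈ u ⊖ u′
⊖-cancel u u′ v p q .at N = trans (⊖-cong p q .at N) (ring (u N) (v N) (u′ N))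
  where
  ring : ∀ u v u′ → (u ℤ.+ v) ℤ.- (u′ ℤ.+ v) ≡ u ℤ.- u′
  ring = ℤSolver.solve-∀

shift-⊖ : ∀ m f g → shift m (f ⊖ g) ≈ shift m f ⊖ shift m g
shift-⊖ zero    f g .at N       = refl
shift-⊖ (suc m) f g .at zero    = refl
shift-⊖ (suc m) f g .at (suc N) = shift-⊖ m f g .at N

-- The combination `X`: recurrence, wall conditions and initial values

module Strip (c₁ c₂ : ℕ) where

  C D K : ℤ
  C = + c₁
  D = + c₂
  K = C ℤ.+ D ℤ.+ + 2

  -- The shifts `s₀` are the even products of reflections in the lines a - b = c₁ + 1 and a - b =
  -- -(c₂ + 1), the shifts `s₁` the odd ones with the two indices exchanged back.
  e₀ e₁ s₀ s₁ : ℤ → ℤ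
  e₀ k = k ℤ.* (+ 2 ℤ.* (k ℤ.* K) ℤ.+ (C ℤ.- D))
  e₁ k = (+ 2 ℤ.* k ℤ.+ 1ℤ) ℤ.* (k ℤ.* K ℤ.+ C ℤ.+ 1ℤ)
  s₀ k = ℤ.- (k ℤ.* K)
  s₁ k = k ℤ.* K ℤ.+ C ℤ.+ 1ℤ

  private
    isC : IsNat C
    isC = pos c₁

    isD : IsNat D
    isD = pos c₂

    isK : IsNat K
    isK = isC ⟨+⟩ isD ⟨+⟩ pos 2

    by : ∀ {x y} → x ≡ y → IsNat y → IsNat x
    by x≡y = subst IsNat (sym x≡y)

  -- `C − D` may be negative; since k is nonzero, one summand 2K of the quadratic part is available
  -- to absorb it.
  e₀-grows : Grows e₀
  e₀-grows (+ zero)  = pos 0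
  e₀-grows (+ suc m) = by (ring (+ m) C D)
    (pos (suc m) ⟨*⟩ (pos 3 ⟨*⟩ isC ⟨+⟩ isD ⟨+⟩ pos 3 ⟨+⟩ pos 2 ⟨*⟩ (pos m ⟨*⟩ isK)))
    where
    ring : ∀ m C D →
      (1ℤ ℤ.+ m) ℤ.* (+ 2 ℤ.* ((1ℤ ℤ.+ m) ℤ.* (C ℤ.+ D ℤ.+ + 2)) ℤ.+ (C ℤ.- D)) ℤ.- (1ℤ ℤ.+ m)
      ≡ (1ℤ ℤ.+ m) ℤ.* (+ 3 ℤ.* C ℤ.+ D ℤ.+ + 3 ℤ.+ + 2 ℤ.* (m ℤ.* (C ℤ.+ D ℤ.+ + 2)))
    ring = ℤSolver.solve-∀
  e₀-grows -[1+ m ] = by (ring (+ m) C D)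
    (pos (suc m) ⟨*⟩ (isC ⟨+⟩ pos 3 ⟨*⟩ isD ⟨+⟩ pos 3 ⟨+⟩ pos 2 ⟨*⟩ (pos m ⟨*⟩ isK)))
    where
    ring : ∀ m C D →
      (ℤ.- (1ℤ ℤ.+ m)) ℤ.* (+ 2 ℤ.* ((ℤ.- (1ℤ ℤ.+ m)) ℤ.* (C ℤ.+ D ℤ.+ + 2)) ℤ.+ (C ℤ.- D)) ℤ.- (1ℤ ℤ.+ m)
      ≡ (1ℤ ℤ.+ m) ℤ.* (C ℤ.+ + 3 ℤ.* D ℤ.+ + 3 ℤ.+ + 2 ℤ.* (m ℤ.* (C ℤ.+ D ℤ.+ + 2)))
    ring = ℤSolver.solve-∀

  e₁-grows : Grows e₁
  e₁-grows (+ m) = by (ring (+ m) C D)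
    ((pos 2 ⟨*⟩ pos m ⟨+⟩ pos 1) ⟨*⟩ (pos m ⟨*⟩ isK ⟨+⟩ isC) ⟨+⟩ pos m ⟨+⟩ pos 1)
    where
    ring : ∀ m C D →
      (+ 2 ℤ.* m ℤ.+ 1ℤ) ℤ.* (m ℤ.* (C ℤ.+ D ℤ.+ + 2) ℤ.+ C ℤ.+ 1ℤ) ℤ.- m
      ≡ (+ 2 ℤ.* m ℤ.+ 1ℤ) ℤ.* (m ℤ.* (C ℤ.+ D ℤ.+ + 2) ℤ.+ C) ℤ.+ m ℤ.+ 1ℤ
    ring = ℤSolver.solve-∀
  e₁-grows -[1+ m ] = by (ring (+ m) C D)
    ((pos 2 ⟨*⟩ pos m ⟨+⟩ pos 1) ⟨*⟩ (pos m ⟨*⟩ isK ⟨+⟩ isD) ⟨+⟩ pos m)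
    where
    ring : ∀ m C D →
      (+ 2 ℤ.* (ℤ.- (1ℤ ℤ.+ m)) ℤ.+ 1ℤ) ℤ.* ((ℤ.- (1ℤ ℤ.+ m)) ℤ.* (C ℤ.+ D ℤ.+ + 2) ℤ.+ C ℤ.+ 1ℤ)
        ℤ.- (1ℤ ℤ.+ m)
      ≡ (+ 2 ℤ.* m ℤ.+ 1ℤ) ℤ.* (m ℤ.* (C ℤ.+ D ℤ.+ + 2) ℤ.+ D) ℤ.+ m
    ring = ℤSolver.solve-∀

  -- Licenses the index shift in `X-lower`. For k > 0 it is stronger than `e₁-grows` at k - 1, which
  -- only gives the bound k - 1.
  e₁-pred-grows : Grows (e₁ ∘ ℤ.pred)
  e₁-pred-grows (+ zero) = by (ring C D) (isD ⟨+⟩ pos 1)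
    where
    ring : ∀ C D →
      (+ 2 ℤ.* -1ℤ ℤ.+ 1ℤ) ℤ.* (-1ℤ ℤ.* (C ℤ.+ D ℤ.+ + 2) ℤ.+ C ℤ.+ 1ℤ) ℤ.- 0ℤ ≡ D ℤ.+ 1ℤ
    ring = ℤSolver.solve-∀
  e₁-pred-grows (+ suc m) = by (ring (+ m) C D)
    ((pos 2 ⟨*⟩ pos m ⟨+⟩ pos 1) ⟨*⟩ (pos m ⟨*⟩ isK ⟨+⟩ isC) ⟨+⟩ pos m)
    where
    ring : ∀ m C D →
      (+ 2 ℤ.* m ℤ.+ 1ℤ) ℤ.* (m ℤ.* (C ℤ.+ D ℤ.+ + 2) ℤ.+ C ℤ.+ 1ℤ) ℤ.- (1ℤ ℤ.+ m)
      ≡ (+ 2 ℤ.* m ℤ.+ 1ℤ) ℤ.* (m ℤ.* (C ℤ.+ D ℤ.+ + 2) ℤ.+ C) ℤ.+ m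
    ring = ℤSolver.solve-∀
  e₁-pred-grows -[1+ m ] = by (ring (+ m) C D)
    ((pos 2 ⟨*⟩ pos m ⟨+⟩ pos 3) ⟨*⟩ (pos m ⟨*⟩ isK ⟨+⟩ isK ⟨+⟩ isD) ⟨+⟩ pos m ⟨+⟩ pos 2)
    where
    ring : ∀ m C D →
      (+ 2 ℤ.* (ℤ.- (+ 2 ℤ.+ m)) ℤ.+ 1ℤ) ℤ.* ((ℤ.- (+ 2 ℤ.+ m)) ℤ.* (C ℤ.+ D ℤ.+ + 2) ℤ.+ C ℤ.+ 1ℤ)
        ℤ.- (1ℤ ℤ.+ m)
      ≡ (+ 2 ℤ.* m ℤ.+ + 3) ℤ.* (m ℤ.* (C ℤ.+ D ℤ.+ + 2) ℤ.+ (C ℤ.+ D ℤ.+ + 2) ℤ.+ D) ℤ.+ m ℤ.+ + 2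
    ring = ℤSolver.solve-∀

  module Θ₀ = Theta e₀ s₀ e₀-grows
  module Θ₁ = Theta e₁ s₁ e₁-grows

  X : ℤ → ℤ → FPS
  X a b = Θ₀.theta a b ⊖ Θ₁.theta a b

  X-rec : ∀ a b {m} → a ℤ.+ b ≡ + m →
    X (ℤ.pred a) b ⊕ X a (ℤ.pred b) ⊕ shift m (X a b) ≈ X a b ⊕ X (ℤ.pred a) (ℤ.pred b)
  X-rec a b {m} a+b≡m = ≈-trans
    (⊕-cong (⊖-⊕ P₀ P₁ Q₀ Q₁) (shift-⊖ m R₀ R₁))
    (≈-trans (⊖-⊕ (P₀ ⊕ Q₀) (P₁ ⊕ Q₁) (shift m R₀) (shift m R₁))
    (≈-trans
      (⊖-cong
        (≈-trans (⊕-congˡ (P₀ ⊕ Q₀) (mono-shift R₀)) (Θ₀.theta-rec a b))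
        (≈-trans (⊕-congˡ (P₁ ⊕ Q₁) (mono-shift R₁)) (Θ₁.theta-rec a b)))
      (≈-sym (⊖-⊕ R₀ R₁ (Θ₀.theta (ℤ.pred a) (ℤ.pred b)) (Θ₁.theta (ℤ.pred a) (ℤ.pred b))))))
    where
    P₀ P₁ Q₀ Q₁ R₀ R₁ : FPS
    P₀ = Θ₀.theta (ℤ.pred a) b
    P₁ = Θ₁.theta (ℤ.pred a) b
    Q₀ = Θ₀.theta a (ℤ.pred b)
    Q₁ = Θ₁.theta a (ℤ.pred b)
    R₀ = Θ₀.theta a b
    R₁ = Θ₁.theta a b

    mono-shift : ∀ f → shift m f ≈ mono (a ℤ.+ b) ⊛ f
    mono-shift f = ≈-sym (≈-trans (⊛-congʳ f (≡⇒≈ (cong mono a+b≡m))) (mono-⊛ m f))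

  private
    e₀-nat : ∀ k → IsNat (e₀ k)
    e₀-nat k = let m , e≡m , _ = Grows⇒IsNat e₀ e₀-grows k in m , e≡m

    e₁-nat : ∀ k → IsNat (e₁ k)
    e₁-nat k = let m , e≡m , _ = Grows⇒IsNat e₁ e₁-grows k in m , e≡m

  -- On this line the k-th boundary terms of the two sums agree by `boundary-swap`, so they cancel
  -- in the difference; `ring₃` is the relation between `e₀ k` and `e₁ k`.
  X-upper : ∀ b → X (b ℤ.+ C ℤ.+ 1ℤ) b ≈ X (ℤ.pred (b ℤ.+ C ℤ.+ 1ℤ)) b
  X-upper b = ⊖-cancel (Θ₀.theta (ℤ.pred a) b) (Θ₁.theta (ℤ.pred a) b) (sumℤ (Θ₀.boundaryˡ a b))
    (Θ₀.theta-predˡ a b)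
    (≈-trans (Θ₁.theta-predˡ a b) (⊕-congˡ (Θ₁.theta (ℤ.pred a) b) (≈-sym (sumℤ-cong cancel))))
    where
    a : ℤ
    a = b ℤ.+ C ℤ.+ 1ℤ

    ring₁ : ∀ b C kK → b ℤ.+ C ℤ.+ 1ℤ ℤ.- (kK ℤ.+ C ℤ.+ 1ℤ) ≡ b ℤ.+ ℤ.- kK
    ring₁ = ℤSolver.solve-∀

    ring₂ : ∀ b C kK → b ℤ.+ (kK ℤ.+ C ℤ.+ 1ℤ) ≡ b ℤ.+ C ℤ.+ 1ℤ ℤ.- (ℤ.- kK)
    ring₂ = ℤSolver.solve-∀

    ring₃ : ∀ b C D k →
      k ℤ.* (+ 2 ℤ.* (k ℤ.* (C ℤ.+ D ℤ.+ + 2)) ℤ.+ (C ℤ.- D)) ℤ.+ (b ℤ.+ C ℤ.+ 1ℤ ℤ.- (ℤ.- (k ℤ.* (C ℤ.+ D ℤ.+ + 2))))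
      ≡ (+ 2 ℤ.* k ℤ.+ 1ℤ) ℤ.* (k ℤ.* (C ℤ.+ D ℤ.+ + 2) ℤ.+ C ℤ.+ 1ℤ) ℤ.+ (b ℤ.+ ℤ.- (k ℤ.* (C ℤ.+ D ℤ.+ + 2)))
    ring₃ = ℤSolver.solve-∀

    cancel : ∀ k → Θ₀.boundaryˡ a b k ≈ Θ₁.boundaryˡ a b k
    cancel k = ≈-trans (boundary-swap (e₀-nat k) (e₁-nat k) (ring₃ b C D k))
      (≡⇒≈ (cong₂ (λ x y → mono (e₁ k) ⊛ ((mono x ⊛ invPoch x) ⊛ invPoch y))
        (sym (ring₁ b C (k ℤ.* K))) (sym (ring₂ b C (k ℤ.* K)))))

  -- As at the upper wall, but term k of the first sum now meets term k - 1 of the second, whence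
  -- the reindexing by `sumℤ-pred`.
  X-lower : ∀ a → X a (a ℤ.+ D ℤ.+ 1ℤ) ≈ X a (ℤ.pred (a ℤ.+ D ℤ.+ 1ℤ))
  X-lower a = ⊖-cancel (Θ₀.theta a (ℤ.pred b)) (Θ₁.theta a (ℤ.pred b)) (sumℤ (Θ₀.boundaryʳ a b))
    (Θ₀.theta-predʳ a b)
    (≈-trans (Θ₁.theta-predʳ a b) (⊕-congˡ (Θ₁.theta a (ℤ.pred b)) (≈-trans
      (sumℤ-pred {Θ₁.boundaryʳ a b}
        (mono-supported e₁ e₁-grows G)
        (mono-supported (e₁ ∘ ℤ.pred) e₁-pred-grows (G ∘ ℤ.pred)))
      (≈-sym (sumℤ-cong cancel)))))
    where
    b : ℤ
    b = a ℤ.+ D ℤ.+ 1ℤ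

    G : ℤ → FPS
    G k = (mono (b ℤ.+ s₁ k) ⊛ invPoch (b ℤ.+ s₁ k)) ⊛ invPoch (a ℤ.- s₁ k)

    ring₁ : ∀ a C D k →
      a ℤ.+ D ℤ.+ 1ℤ ℤ.+ ((-1ℤ ℤ.+ k) ℤ.* (C ℤ.+ D ℤ.+ + 2) ℤ.+ C ℤ.+ 1ℤ) ≡ a ℤ.- (ℤ.- (k ℤ.* (C ℤ.+ D ℤ.+ + 2)))
    ring₁ = ℤSolver.solve-∀

    ring₂ : ∀ a C D k →
      a ℤ.- ((-1ℤ ℤ.+ k) ℤ.* (C ℤ.+ D ℤ.+ + 2) ℤ.+ C ℤ.+ 1ℤ) ≡ a ℤ.+ D ℤ.+ 1ℤ ℤ.+ ℤ.- (k ℤ.* (C ℤ.+ D ℤ.+ + 2))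
    ring₂ = ℤSolver.solve-∀

    ring₃ : ∀ a C D k →
      k ℤ.* (+ 2 ℤ.* (k ℤ.* (C ℤ.+ D ℤ.+ + 2)) ℤ.+ (C ℤ.- D)) ℤ.+ (a ℤ.+ D ℤ.+ 1ℤ ℤ.+ (ℤ.- (k ℤ.* (C ℤ.+ D ℤ.+ + 2))))
      ≡ (+ 2 ℤ.* (-1ℤ ℤ.+ k) ℤ.+ 1ℤ) ℤ.* ((-1ℤ ℤ.+ k) ℤ.* (C ℤ.+ D ℤ.+ + 2) ℤ.+ C ℤ.+ 1ℤ)
        ℤ.+ (a ℤ.- (ℤ.- (k ℤ.* (C ℤ.+ D ℤ.+ + 2))))
    ring₃ = ℤSolver.solve-∀

    cancel : ∀ k → Θ₀.boundaryʳ a b k ≈ Θ₁.boundaryʳ a b (ℤ.pred k)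
    cancel k = ≈-trans (boundary-swap (e₀-nat k) (e₁-nat (ℤ.pred k)) (ring₃ a C D k))
      (≡⇒≈ (cong₂ (λ x y → mono (e₁ (ℤ.pred k)) ⊛ ((mono x ⊛ invPoch x) ⊛ invPoch y))
        (sym (ring₁ a C D k)) (sym (ring₂ a C D k))))

  private
    X-zero : ∀ a b →
      (∀ k → IsNat (-1ℤ ℤ.- (a ℤ.- s₀ k)) ⊎ IsNat (-1ℤ ℤ.- (b ℤ.+ s₀ k))) →
      (∀ k → IsNat (-1ℤ ℤ.- (a ℤ.- s₁ k)) ⊎ IsNat (-1ℤ ℤ.- (b ℤ.+ s₁ k))) →
      X a b ≈ zeroS
    X-zero a b neg₀ neg₁ .at N =
      cong₂ ℤ._-_ (Θ₀.theta-zero a b neg₀ .at N) (Θ₁.theta-zero a b neg₁ .at N)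

  -- Every term has a negative index. The sharp case is k = -1 of the second sum, whose second index
  -- is b - c₂ - 1; it is negative because b ≤ c₂.
  X-negˡ : ∀ b → IsNat (D ℤ.- b) → X -1ℤ b ≈ zeroS
  X-negˡ b b≤D = X-zero -1ℤ b neg₀ neg₁
    where
    neg₀ : ∀ k → IsNat (-1ℤ ℤ.- (-1ℤ ℤ.- s₀ k)) ⊎ IsNat (-1ℤ ℤ.- (b ℤ.+ s₀ k))
    neg₀ (+ zero)  = inj₁ (pos 0)
    neg₀ (+ suc m) = inj₂ (by (ring (+ m) C D b) (b≤D ⟨+⟩ isC ⟨+⟩ pos 1 ⟨+⟩ pos m ⟨*⟩ isK))
      where
      ring : ∀ m C D b → -1ℤ ℤ.- (b ℤ.+ ℤ.- ((1ℤ ℤ.+ m) ℤ.* (C ℤ.+ D ℤ.+ + 2)))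
                       ≡ (D ℤ.- b) ℤ.+ C ℤ.+ 1ℤ ℤ.+ m ℤ.* (C ℤ.+ D ℤ.+ + 2)
      ring = ℤSolver.solve-∀
    neg₀ -[1+ m ] = inj₁ (by (ring (+ m) C D) (pos (suc m) ⟨*⟩ isK))
      where
      ring : ∀ m C D → -1ℤ ℤ.- (-1ℤ ℤ.- (ℤ.- ((ℤ.- (1ℤ ℤ.+ m)) ℤ.* (C ℤ.+ D ℤ.+ + 2))))
                     ≡ (1ℤ ℤ.+ m) ℤ.* (C ℤ.+ D ℤ.+ + 2)
      ring = ℤSolver.solve-∀

    neg₁ : ∀ k → IsNat (-1ℤ ℤ.- (-1ℤ ℤ.- s₁ k)) ⊎ IsNat (-1ℤ ℤ.- (b ℤ.+ s₁ k))
    neg₁ (+ m) = inj₁ (by (ring (s₁ (+ m))) (pos m ⟨*⟩ isK ⟨+⟩ isC ⟨+⟩ pos 1))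
      where
      ring : ∀ s → -1ℤ ℤ.- (-1ℤ ℤ.- s) ≡ s
      ring = ℤSolver.solve-∀
    neg₁ -[1+ m ] = inj₂ (by (ring (+ m) C D b) (b≤D ⟨+⟩ pos m ⟨*⟩ isK))
      where
      ring : ∀ m C D b →
        -1ℤ ℤ.- (b ℤ.+ ((ℤ.- (1ℤ ℤ.+ m)) ℤ.* (C ℤ.+ D ℤ.+ + 2) ℤ.+ C ℤ.+ 1ℤ))
        ≡ (D ℤ.- b) ℤ.+ m ℤ.* (C ℤ.+ D ℤ.+ + 2)
      ring = ℤSolver.solve-∀

  X-negʳ : ∀ a → IsNat (C ℤ.- a) → X a -1ℤ ≈ zeroS
  X-negʳ a a≤C = X-zero a -1ℤ neg₀ neg₁
    where
    neg₀ : ∀ k → IsNat (-1ℤ ℤ.- (a ℤ.- s₀ k)) ⊎ IsNat (-1ℤ ℤ.- (-1ℤ ℤ.+ s₀ k))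
    neg₀ (+ m) = inj₂ (by (ring (+ m ℤ.* K)) (pos m ⟨*⟩ isK))
      where
      ring : ∀ mK → -1ℤ ℤ.- (-1ℤ ℤ.+ ℤ.- mK) ≡ mK
      ring = ℤSolver.solve-∀
    neg₀ -[1+ m ] = inj₁ (by (ring (+ m) C D a) (a≤C ⟨+⟩ isD ⟨+⟩ pos 1 ⟨+⟩ pos m ⟨*⟩ isK))
      where
      ring : ∀ m C D a → -1ℤ ℤ.- (a ℤ.- (ℤ.- ((ℤ.- (1ℤ ℤ.+ m)) ℤ.* (C ℤ.+ D ℤ.+ + 2))))
                       ≡ (C ℤ.- a) ℤ.+ D ℤ.+ 1ℤ ℤ.+ m ℤ.* (C ℤ.+ D ℤ.+ + 2)
      ring = ℤSolver.solve-∀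

    neg₁ : ∀ k → IsNat (-1ℤ ℤ.- (a ℤ.- s₁ k)) ⊎ IsNat (-1ℤ ℤ.- (-1ℤ ℤ.+ s₁ k))
    -- Sharp at m = 0, where the first index is a - c₁ - 1.
    neg₁ (+ m) = inj₁ (by (ring (+ m ℤ.* K) C a) (a≤C ⟨+⟩ pos m ⟨*⟩ isK))
      where
      ring : ∀ mK C a → -1ℤ ℤ.- (a ℤ.- (mK ℤ.+ C ℤ.+ 1ℤ)) ≡ (C ℤ.- a) ℤ.+ mK
      ring = ℤSolver.solve-∀
    neg₁ -[1+ m ] = inj₂ (by (ring (+ m) C D) (isD ⟨+⟩ pos 1 ⟨+⟩ pos m ⟨*⟩ isK))
      where
      ring : ∀ m C D →
        -1ℤ ℤ.- (-1ℤ ℤ.+ ((ℤ.- (1ℤ ℤ.+ m)) ℤ.* (C ℤ.+ D ℤ.+ + 2) ℤ.+ C ℤ.+ 1ℤ))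
        ≡ D ℤ.+ 1ℤ ℤ.+ m ℤ.* (C ℤ.+ D ℤ.+ + 2)
      ring = ℤSolver.solve-∀

  -- Only k = 0 of the first sum has both indices nonnegative.
  X-origin : X 0ℤ 0ℤ ≈ oneS
  X-origin .at N = begin
    Θ₀.theta 0ℤ 0ℤ N ℤ.- Θ₁.theta 0ℤ 0ℤ N
      ≡⟨ cong₂ ℤ._-_ (sumℤ-single (Θ₀.weighted 0ℤ 0ℤ) (λ k 0<k → Θ₀.weighted-zero 0ℤ 0ℤ k (neg₀ k 0<k)) .at N)
           (Θ₁.theta-zero 0ℤ 0ℤ neg₁ .at N) ⟩
    (mono (+ 0) ⊛ (oneS ⊛ oneS)) N ℤ.- 0ℤ
      ≡⟨ ℤP.+-identityʳ _ ⟩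
    (mono (+ 0) ⊛ (oneS ⊛ oneS)) N
      ≡⟨ ≈-trans (⊛-cong mono-0 (oneS-⊛ oneS)) (oneS-⊛ oneS) .at N ⟩
    oneS N ∎
    where
    neg₀ : ∀ k → 0 ℕ.< ∣ k ∣ → IsNat (-1ℤ ℤ.- (0ℤ ℤ.- s₀ k)) ⊎ IsNat (-1ℤ ℤ.- (0ℤ ℤ.+ s₀ k))
    neg₀ (+ suc m) _ = inj₂ (by (ring (+ m) C D) (isC ⟨+⟩ isD ⟨+⟩ pos 1 ⟨+⟩ pos m ⟨*⟩ isK))
      where
      ring : ∀ m C D → -1ℤ ℤ.- (0ℤ ℤ.+ ℤ.- ((1ℤ ℤ.+ m) ℤ.* (C ℤ.+ D ℤ.+ + 2)))
                     ≡ C ℤ.+ D ℤ.+ 1ℤ ℤ.+ m ℤ.* (C ℤ.+ D ℤ.+ + 2)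
      ring = ℤSolver.solve-∀
    neg₀ -[1+ m ] _ = inj₁ (by (ring (+ m) C D) (isC ⟨+⟩ isD ⟨+⟩ pos 1 ⟨+⟩ pos m ⟨*⟩ isK))
      where
      ring : ∀ m C D → -1ℤ ℤ.- (0ℤ ℤ.- (ℤ.- ((ℤ.- (1ℤ ℤ.+ m)) ℤ.* (C ℤ.+ D ℤ.+ + 2))))
                     ≡ C ℤ.+ D ℤ.+ 1ℤ ℤ.+ m ℤ.* (C ℤ.+ D ℤ.+ + 2)
      ring = ℤSolver.solve-∀

    neg₁ : ∀ k → IsNat (-1ℤ ℤ.- (0ℤ ℤ.- s₁ k)) ⊎ IsNat (-1ℤ ℤ.- (0ℤ ℤ.+ s₁ k))
    neg₁ (+ m) = inj₁ (by (ring (+ m ℤ.* K) C) (isC ⟨+⟩ pos m ⟨*⟩ isK))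
      where
      ring : ∀ mK C → -1ℤ ℤ.- (0ℤ ℤ.- (mK ℤ.+ C ℤ.+ 1ℤ)) ≡ C ℤ.+ mK
      ring = ℤSolver.solve-∀
    neg₁ -[1+ m ] = inj₂ (by (ring (+ m) C D) (isD ⟨+⟩ pos m ⟨*⟩ isK))
      where
      ring : ∀ m C D →
        -1ℤ ℤ.- (0ℤ ℤ.+ ((ℤ.- (1ℤ ℤ.+ m)) ℤ.* (C ℤ.+ D ℤ.+ + 2) ℤ.+ C ℤ.+ 1ℤ))
        ≡ D ℤ.+ m ℤ.* (C ℤ.+ D ℤ.+ + 2)
      ring = ℤSolver.solve-∀

-- Counting cylindric partitions

unique-length : ∀ {A : Set} {xs ys : List A} → Unique xs → Unique ys →
  (∀ {x} → x ∈ xs → x ∈ ys) → (∀ {x} → x ∈ ys → x ∈ xs) → length xs ≡ length ys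
unique-length xs! ys! to from = ↭-length (∼bag⇒↭ (unique∧set⇒bag xs! ys! (mk⇔ to from)))

module _ {A : Set} where

  length-filter-⇔ : ∀ {P Q : A → Set} (P? : Decidable P) (Q? : Decidable Q) →
    (∀ x → P x → Q x) → (∀ x → Q x → P x) → ∀ xs → length (filter P? xs) ≡ length (filter Q? xs)
  length-filter-⇔ P? Q? to from []       = refl
  length-filter-⇔ P? Q? to from (x ∷ xs) with P? x | Q? x
  ... | yes _ | yes _ = cong suc (length-filter-⇔ P? Q? to from xs)
  ... | no _  | no _  = length-filter-⇔ P? Q? to from xs
  ... | yes p | no ¬q = contradiction (to x p) ¬q
  ... | no ¬p | yes q = contradiction (from x q) ¬p

  private
    suc-middle : ∀ u v w → suc (u ℕ.+ v ℕ.+ w) ≡ u ℕ.+ suc v ℕ.+ w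
    suc-middle = ℕSolver.solve-∀

  -- Kept free of subtraction so that it can be counted in ℕ, element by element.
  inclusion-exclusion : ∀ {P U V : A → Set} (P? : Decidable P) (U? : Decidable U) (V? : Decidable V) xs →
    length (filter P? xs) ℕ.+ length (filter (λ x → P? x ×-dec (U? x ×-dec V? x)) xs)
    ≡ length (filter (λ x → P? x ×-dec U? x) xs) ℕ.+ length (filter (λ x → P? x ×-dec V? x) xs)
      ℕ.+ length (filter (λ x → P? x ×-dec (¬? (U? x) ×-dec ¬? (V? x))) xs)
  inclusion-exclusion P? U? V? []       = refl
  inclusion-exclusion P? U? V? (x ∷ xs)
    with ih ← inclusion-exclusion P? U? V? xs | does (P? x) | does (U? x) | does (V? x)
  ... | false | _     | _     = ih
  ... | true  | true  | true  = cong suc (trans (ℕP.+-suc _ _) (trans (cong suc ih)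
     (suc-middle (length (filter (λ x → P? x ×-dec U? x) xs)) _ _)))
  ... | true  | true  | false = cong suc ih
  ... | true  | false | true  = trans (cong suc ih) (suc-middle (length (filter (λ x → P? x ×-dec U? x) xs)) _ _)
  ... | true  | false | false = trans (cong suc ih) (sym (ℕP.+-suc _ _))

concatMap-map≡cartesianProductWith : ∀ {A B C : Set} (f : A → B → C) xs ys →
  concatMap (λ x → map (f x) ys) xs ≡ cartesianProductWith f xs ys
concatMap-map≡cartesianProductWith f []       ys = refl
concatMap-map≡cartesianProductWith f (x ∷ xs) ys =
  cong (map (f x) ys ++_) (concatMap-map≡cartesianProductWith f xs ys)

allVecs-unique : ∀ n N → Unique (allVecs n N)
allVecs-unique zero    N = All.[] ∷ []
allVecs-unique (suc n) N = subst Unique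
  (sym (concatMap-map≡cartesianProductWith _∷_ (upTo (suc N)) (allVecs n N)))
  (Unique.cartesianProductWith⁺ _∷_ VecP.∷-injective (Unique.upTo⁺ (suc N)) (allVecs-unique n N))

allPairs-unique : ∀ n N → Unique (allPairs n N)
allPairs-unique n N = subst Unique
  (sym (concatMap-map≡cartesianProductWith _,_ (allVecs n N) (allVecs n N)))
  (Unique.cartesianProduct⁺ (allVecs-unique n N) (allVecs-unique n N))

∈-allVecs : ∀ {n N} (v : Vec ℕ n) → size v ℕ.≤ N → v ∈ allVecs n N
∈-allVecs []      _ = here refl
∈-allVecs {suc n} {N} (x ∷ v) x+v≤N = subst (x ∷ v ∈_)
  (sym (concatMap-map≡cartesianProductWith _∷_ (upTo (suc N)) (allVecs n N)))
  (∈-cartesianProductWith⁺ _∷_ (∈-upTo⁺ (s≤s (ℕP.m+n≤o⇒m≤o x x+v≤N)))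
    (∈-allVecs v (ℕP.m+n≤o⇒n≤o x x+v≤N)))

∈-allPairs : ∀ {n N} (u v : Vec ℕ n) → size u ℕ.+ size v ≡ N → (u , v) ∈ allPairs n N
∈-allPairs {n} {N} u v refl = subst ((u , v) ∈_)
  (sym (concatMap-map≡cartesianProductWith _,_ (allVecs n N) (allVecs n N)))
  (∈-cartesianProductWith⁺ _,_ (∈-allVecs u (ℕP.m≤m+n (size u) (size v)))
    (∈-allVecs v (ℕP.m≤n+m (size v) (size u))))

-- Adding and removing a column

part-beyond : ∀ {n} (v : Vec ℕ n) {j} → n ℕ.≤ j → part v j ≡ 0
part-beyond []      _         = refl
part-beyond (x ∷ v) (s≤s n≤j) = part-beyond v n≤j

-- Turns the conditions over `Fin n` into conditions over all natural indices, so that shifted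
-- indices such as j + c need no bound.
≤-everywhere : ∀ {n} {f g : ℕ → ℕ} → (∀ {j} → n ℕ.≤ j → f j ≡ 0) →
  (∀ (i : Fin n) → f (toℕ i) ℕ.≤ g (toℕ i)) → ∀ j → f j ℕ.≤ g j
≤-everywhere {n} {f} {g} f≡0 f≤g j with j ℕ.<? n
... | yes j<n = subst (λ i → f i ℕ.≤ g i) (FinP.toℕ-fromℕ< j<n) (f≤g (fromℕ< j<n))
... | no j≮n  = subst (ℕ._≤ g j) (sym (f≡0 (ℕP.≮⇒≥ j≮n))) z≤n

-- One shape for all four conditions: `Descends 1 v v` for each partition, and `Descends c₂ l₂ l₁`,
-- `Descends c₁ l₁ l₂` for the cylindric inequalities. Columns then need to be treated only once.
Descends : ∀ {n} → ℕ → Vec ℕ n → Vec ℕ n → Set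
Descends c u v = ∀ j → part u (j ℕ.+ c) ℕ.≤ part v j

descends : ∀ {n} c (u v : Vec ℕ n) →
  (∀ (i : Fin n) → part u (toℕ i ℕ.+ c) ℕ.≤ part v (toℕ i)) → Descends c u v
descends c u v = ≤-everywhere λ n≤j → part-beyond u (ℕP.m≤n⇒m≤n+o c n≤j)

partition⇒descends : ∀ {n} (v : Vec ℕ n) → IsPartition v → Descends 1 v v
partition⇒descends v v↓ = descends 1 v v λ i →
  subst (λ j → part v j ℕ.≤ part v (toℕ i)) (ℕP.+-comm 1 (toℕ i)) (v↓ i)

descends⇒partition : ∀ {n} (v : Vec ℕ n) → Descends 1 v v → IsPartition v
descends⇒partition v v↓ i =
  subst (λ j → part v j ℕ.≤ part v (toℕ i)) (ℕP.+-comm (toℕ i) 1) (v↓ (toℕ i))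

part-antitone : ∀ {n} (v : Vec ℕ n) → Descends 1 v v → ∀ {i j} → i ℕ.≤ j → part v j ℕ.≤ part v i
part-antitone v v↓ {i} i≤j with ℕP.m≤n⇒∃[o]m+o≡n i≤j
... | o , refl = go o
  where
  go : ∀ o → part v (i ℕ.+ o) ℕ.≤ part v i
  go zero    = ℕP.≤-reflexive (cong (part v) (ℕP.+-identityʳ i))
  go (suc o) = ℕP.≤-trans
    (subst (λ j → part v j ℕ.≤ part v (i ℕ.+ o))
      (trans (ℕP.+-comm (i ℕ.+ o) 1) (sym (ℕP.+-suc i o))) (v↓ (i ℕ.+ o)))
    (go o)

addColumn : ∀ {n} → ℕ → Vec ℕ n → Vec ℕ n
addColumn zero    v       = v
addColumn (suc a) []      = []
addColumn (suc a) (x ∷ v) = suc x ∷ addColumn a v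

part-addColumn-< : ∀ {n a} (v : Vec ℕ n) → a ℕ.≤ n → ∀ {j} → j ℕ.< a →
  part (addColumn a v) j ≡ suc (part v j)
part-addColumn-< (x ∷ v) (s≤s a≤n) {zero}  (s≤s j<a) = refl
part-addColumn-< (x ∷ v) (s≤s a≤n) {suc j} (s≤s j<a) = part-addColumn-< v a≤n j<a

part-addColumn-≥ : ∀ {n} a (v : Vec ℕ n) {j} → a ℕ.≤ j → part (addColumn a v) j ≡ part v j
part-addColumn-≥ zero    v       _         = refl
part-addColumn-≥ (suc a) []      _         = refl
part-addColumn-≥ (suc a) (x ∷ v) (s≤s a≤j) = part-addColumn-≥ a v a≤j

size-addColumn : ∀ {n a} (v : Vec ℕ n) → a ℕ.≤ n → size (addColumn a v) ≡ a ℕ.+ size v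
size-addColumn {a = zero}  v       _         = refl
size-addColumn {a = suc a} (x ∷ v) (s≤s a≤n) = cong suc (begin
  x ℕ.+ size (addColumn a v) ≡⟨ cong (x ℕ.+_) (size-addColumn v a≤n) ⟩
  x ℕ.+ (a ℕ.+ size v)       ≡⟨ lemma x a (size v) ⟩
  a ℕ.+ (x ℕ.+ size v)       ∎)
  where
  lemma : ∀ x a s → x ℕ.+ (a ℕ.+ s) ≡ a ℕ.+ (x ℕ.+ s)
  lemma = ℕSolver.solve-∀

addColumn-injective : ∀ {n} a {u v : Vec ℕ n} → addColumn a u ≡ addColumn a v → u ≡ v
addColumn-injective zero    eq = eq
addColumn-injective (suc a) {[]}    {[]}    eq = refl
addColumn-injective (suc a) {x ∷ u} {y ∷ v} eq with VecP.∷-injective eq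
... | refl , eq′ = cong (x ∷_) (addColumn-injective a eq′)

addColumn-surjective : ∀ {n} a (v : Vec ℕ n) → (∀ {j} → j ℕ.< a → part v j ≢ 0) →
  ∃ λ u → v ≡ addColumn a u
addColumn-surjective zero    v           _   = v , refl
addColumn-surjective (suc a) []          _   = [] , refl
addColumn-surjective (suc a) (zero ∷ v)  v≢0 = contradiction refl (v≢0 (s≤s z≤n))
addColumn-surjective (suc a) (suc x ∷ v) v≢0 with addColumn-surjective a v (v≢0 ∘ s≤s)
... | u , refl = x ∷ u , refl

-- The hypothesis b ≤ a + c is what lets a column of heights (a, b) be added or removed.
addColumn-descends : ∀ {n a b c} (u v : Vec ℕ n) → a ℕ.≤ n → b ℕ.≤ n → b ℕ.≤ a ℕ.+ c →
  Descends c u v → Descends c (addColumn b u) (addColumn a v)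
addColumn-descends {n} {a} {b} {c} u v a≤n b≤n b≤a+c u≤v j with j ℕ.<? a | j ℕ.+ c ℕ.<? b
... | yes j<a | yes j+c<b = subst₂ ℕ._≤_
  (sym (part-addColumn-< u b≤n j+c<b)) (sym (part-addColumn-< v a≤n j<a)) (s≤s (u≤v j))
... | yes j<a | no j+c≮b = subst₂ ℕ._≤_
  (sym (part-addColumn-≥ b u (ℕP.≮⇒≥ j+c≮b))) (sym (part-addColumn-< v a≤n j<a)) (ℕP.m≤n⇒m≤1+n (u≤v j))
... | no j≮a | yes j+c<b = contradiction
  (ℕP.+-cancelʳ-< c j a (ℕP.<-≤-trans j+c<b b≤a+c)) j≮a
... | no j≮a | no j+c≮b = subst₂ ℕ._≤_
  (sym (part-addColumn-≥ b u (ℕP.≮⇒≥ j+c≮b))) (sym (part-addColumn-≥ a v (ℕP.≮⇒≥ j≮a))) (u≤v j)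

-- If j + c < b then j < a, and both parts lose 1. Otherwise the part of `u` is 0, because the
-- removed column is the longest one.
addColumn-descends⁻ : ∀ {n a b c} (u v : Vec ℕ n) → a ℕ.≤ n → b ℕ.≤ n → b ℕ.≤ a ℕ.+ c →
  (∀ {j} → b ℕ.≤ j → part (addColumn b u) j ≡ 0) →
  Descends c (addColumn b u) (addColumn a v) → Descends c u v
addColumn-descends⁻ {n} {a} {b} {c} u v a≤n b≤n b≤a+c u≡0 u≤v j with j ℕ.+ c ℕ.<? b
... | yes j+c<b = ℕP.≤-pred (subst₂ ℕ._≤_
  (part-addColumn-< u b≤n j+c<b)
  (part-addColumn-< v a≤n (ℕP.+-cancelʳ-< c j a (ℕP.<-≤-trans j+c<b b≤a+c))) (u≤v j))
... | no j+c≮b = subst (ℕ._≤ part v j)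
  (trans (sym (u≡0 (ℕP.≮⇒≥ j+c≮b))) (part-addColumn-≥ b u (ℕP.≮⇒≥ j+c≮b))) z≤n

-- "Fewer than a parts" rather than "at most a parts": the boundary case a = 0 is then impossible,
-- so that the counts vanish there just as X(−1, b) does.
Fewer : ∀ {n} → ℕ → Vec ℕ n → Set
Fewer zero    v = ⊥
Fewer (suc a) v = part v a ≡ 0

fewer? : ∀ {n} a (v : Vec ℕ n) → Dec (Fewer a v)
fewer? zero    v = no id
fewer? (suc a) v = part v a ℕP.≟ 0

fewer⇒zero : ∀ {n} (v : Vec ℕ n) → Descends 1 v v → ∀ {a j} → Fewer (suc a) v → a ℕ.≤ j → part v j ≡ 0
fewer⇒zero v v↓ va≡0 a≤j = ℕP.n≤0⇒n≡0 (ℕP.≤-trans (part-antitone v v↓ a≤j) (ℕP.≤-reflexive va≡0))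

fewer-suc : ∀ {n} (v : Vec ℕ n) → Descends 1 v v → ∀ {a} → Fewer a v → Fewer (suc a) v
fewer-suc v v↓ {suc a} va≡0 = fewer⇒zero v v↓ {a} va≡0 (ℕP.n≤1+n a)

addColumn-fewer : ∀ {n} a (v : Vec ℕ n) → Fewer (suc a) v → Fewer (suc a) (addColumn a v)
addColumn-fewer a v = trans (part-addColumn-≥ a v ℕP.≤-refl)

addColumn-not-fewer : ∀ {n a} (v : Vec ℕ n) → a ℕ.≤ n → ¬ Fewer a (addColumn a v)
addColumn-not-fewer {a = suc a} v a≤n eq with () ← trans (sym (part-addColumn-< v a≤n (ℕP.n<1+n a))) eq

not-fewer⇒positive : ∀ {n} (v : Vec ℕ n) → Descends 1 v v → ∀ {a j} → ¬ Fewer a v → j ℕ.< a → part v j ≢ 0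
not-fewer⇒positive v v↓ {suc a} va≢0 (s≤s j≤a) vj≡0 =
  va≢0 (ℕP.n≤0⇒n≡0 (ℕP.≤-trans (part-antitone v v↓ j≤a) (ℕP.≤-reflexive vj≡0)))

-- Recurrence, wall conditions and initial values of the counts

module Count (c₁ c₂ n : ℕ) where

  CPs : ℕ → ℕ → ℕ → Vec ℕ n × Vec ℕ n → Set
  CPs a b N p = IsCP c₁ c₂ n N p × Fewer a (proj₁ p) × Fewer b (proj₂ p)

  CPs? : ∀ a b N → Decidable (CPs a b N)
  CPs? a b N p = isCP? c₁ c₂ n N p ×-dec (fewer? a (proj₁ p) ×-dec fewer? b (proj₂ p))

  -- Exactly a and b parts, that is, the largest column is (a, b).
  Exact : ℕ → ℕ → ℕ → Vec ℕ n × Vec ℕ n → Set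
  Exact a b N p = CPs (suc a) (suc b) N p × (¬ Fewer a (proj₁ p) × ¬ Fewer b (proj₂ p))

  Exact? : ∀ a b N → Decidable (Exact a b N)
  Exact? a b N p = CPs? (suc a) (suc b) N p ×-dec (¬? (fewer? a (proj₁ p)) ×-dec ¬? (fewer? b (proj₂ p)))

  #CPs : ℕ → ℕ → ℕ → ℕ
  #CPs a b N = length (filter (CPs? a b N) (allPairs n N))

  #Exact : ℕ → ℕ → ℕ → ℕ
  #Exact a b N = length (filter (Exact? a b N) (allPairs n N))

  -- Indices are one higher than in the overview: `F (suc a) (suc b)` is its F(a, b), and `F 0 b`,
  -- `F a 0` stand for index -1.
  F : ℕ → ℕ → FPS
  F a b N = + #CPs a b N

  CP≈F : CP c₁ c₂ n ≈ F (suc n) (suc n)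
  CP≈F .at N = cong +_ (length-filter-⇔ (isCP? c₁ c₂ n N) (CPs? (suc n) (suc n) N)
    (λ p cp → cp , part-beyond (proj₁ p) ℕP.≤-refl , part-beyond (proj₂ p) ℕP.≤-refl)
    (λ p → proj₁) (allPairs n N))

  F-zeroˡ : ∀ b → F 0 b ≈ zeroS
  F-zeroˡ b .at N = cong (λ xs → + length xs)
    (ListP.filter-none (CPs? 0 b N) (All.universal (λ _ → proj₁ ∘ proj₂) (allPairs n N)))

  F-zeroʳ : ∀ a → F a 0 ≈ zeroS
  F-zeroʳ a .at N = cong (λ xs → + length xs)
    (ListP.filter-none (CPs? a 0 N) (All.universal (λ _ → proj₂ ∘ proj₂) (allPairs n N)))

  private
    parts : ∀ {N} p → IsCP c₁ c₂ n N p →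
      let u , v = p in Descends 1 u u × Descends 1 v v × Descends c₂ v u × Descends c₁ u v
    parts (u , v) (u↓ , v↓ , (v≤u , u≤v) , _) =
      partition⇒descends u u↓ , partition⇒descends v v↓ , descends c₂ v u v≤u , descends c₁ u v u≤v

    isCP : ∀ {N} u v → Descends 1 u u → Descends 1 v v → Descends c₂ v u → Descends c₁ u v →
      size u ℕ.+ size v ≡ N → IsCP c₁ c₂ n N (u , v)
    isCP u v u↓ v↓ v≤u u≤v eq = descends⇒partition u u↓ , descends⇒partition v v↓ ,
      ((λ i → v≤u (toℕ i)) , (λ i → u≤v (toℕ i))) , eq

    size-of : ∀ {N} p → IsCP c₁ c₂ n N p → size (proj₁ p) ℕ.+ size (proj₂ p) ≡ N
    size-of p (_ , _ , _ , eq) = eq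

  #-rec : ∀ a b N →
    #CPs (suc a) (suc b) N ℕ.+ #CPs a b N ≡ #CPs a (suc b) N ℕ.+ #CPs (suc a) b N ℕ.+ #Exact a b N
  #-rec a b N = begin
    #CPs (suc a) (suc b) N ℕ.+ #CPs a b N
      ≡⟨ cong (#CPs (suc a) (suc b) N ℕ.+_) (length-filter-⇔ (CPs? a b N) _
           (λ p (cp , ua , vb) → let u↓ , v↓ , _ = parts p cp in
             (cp , fewer-suc (proj₁ p) u↓ ua , fewer-suc (proj₂ p) v↓ vb) , ua , vb)
           (λ p ((cp , _) , ua , vb) → cp , ua , vb) (allPairs n N)) ⟩
    #CPs (suc a) (suc b) N ℕ.+ length (filter (λ p → CPs? (suc a) (suc b) N p ×-dec (U? p ×-dec V? p)) (allPairs n N))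
      ≡⟨ inclusion-exclusion (CPs? (suc a) (suc b) N) U? V? (allPairs n N) ⟩
    length (filter (λ p → CPs? (suc a) (suc b) N p ×-dec U? p) (allPairs n N))
      ℕ.+ length (filter (λ p → CPs? (suc a) (suc b) N p ×-dec V? p) (allPairs n N)) ℕ.+ #Exact a b N
      ≡⟨ cong (ℕ._+ #Exact a b N) (cong₂ ℕ._+_
           (length-filter-⇔ _ (CPs? a (suc b) N)
             (λ p ((cp , _ , vb) , ua) → cp , ua , vb)
             (λ p (cp , ua , vb) → (cp , fewer-suc (proj₁ p) (proj₁ (parts p cp)) ua , vb) , ua) (allPairs n N))
           (length-filter-⇔ _ (CPs? (suc a) b N)
             (λ p ((cp , ua , _) , vb) → cp , ua , vb)
             (λ p (cp , ua , vb) → (cp , ua , fewer-suc (proj₂ p) (proj₁ (proj₂ (parts p cp))) vb) , vb) (allPairs n N))) ⟩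
    #CPs a (suc b) N ℕ.+ #CPs (suc a) b N ℕ.+ #Exact a b N ∎
    where
    U? : Decidable {A = Vec ℕ n × Vec ℕ n} (Fewer a ∘ proj₁)
    U? p = fewer? a (proj₁ p)
    V? : Decidable {A = Vec ℕ n × Vec ℕ n} (Fewer b ∘ proj₂)
    V? p = fewer? b (proj₂ p)

  -- The column (a, b) fits into vectors of length n and lies in the strip, so it can be added to
  -- and removed from a cylindric partition.
  module _ {a b : ℕ} (a≤n : a ℕ.≤ n) (b≤n : b ℕ.≤ n) (a≤b+c₁ : a ℕ.≤ b ℕ.+ c₁) (b≤a+c₂ : b ℕ.≤ a ℕ.+ c₂) where

    private
      add : Vec ℕ n × Vec ℕ n → Vec ℕ n × Vec ℕ n
      add (u , v) = addColumn a u , addColumn b v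

      add-injective : ∀ {p q} → add p ≡ add q → p ≡ q
      add-injective eq = cong₂ _,_ (addColumn-injective a (cong proj₁ eq)) (addColumn-injective b (cong proj₂ eq))

      size-add : ∀ u v → size (addColumn a u) ℕ.+ size (addColumn b v) ≡ (a ℕ.+ b) ℕ.+ (size u ℕ.+ size v)
      size-add u v = trans (cong₂ ℕ._+_ (size-addColumn u a≤n) (size-addColumn v b≤n))
        (lemma a (size u) b (size v))
        where
        lemma : ∀ a s b t → (a ℕ.+ s) ℕ.+ (b ℕ.+ t) ≡ (a ℕ.+ b) ℕ.+ (s ℕ.+ t)
        lemma = ℕSolver.solve-∀

      add-exact : ∀ M p → CPs (suc a) (suc b) M p → Exact a b (a ℕ.+ b ℕ.+ M) (add p)
      add-exact M (u , v) (cp , ua , vb) =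
        (isCP (addColumn a u) (addColumn b v)
          (addColumn-descends u u a≤n a≤n (ℕP.m≤m+n a 1) u↓)
          (addColumn-descends v v b≤n b≤n (ℕP.m≤m+n b 1) v↓)
          (addColumn-descends v u a≤n b≤n b≤a+c₂ v≤u)
          (addColumn-descends u v b≤n a≤n a≤b+c₁ u≤v)
          (trans (size-add u v) (cong (a ℕ.+ b ℕ.+_) (size-of (u , v) cp)))
        , addColumn-fewer a u ua , addColumn-fewer b v vb)
        , addColumn-not-fewer u a≤n , addColumn-not-fewer v b≤n
        where
        ds = parts (u , v) cp
        u↓ = proj₁ ds
        v↓ = proj₁ (proj₂ ds)
        v≤u = proj₁ (proj₂ (proj₂ ds))
        u≤v = proj₂ (proj₂ (proj₂ ds))

      -- `N` is not assumed to be of the form a + b + M, so that the same inversion serves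
      -- `#Exact-+` and, by contradiction, `#Exact-<`.
      exact-add : ∀ {N} p → Exact a b N p →
        ∃ λ q → p ≡ add q × (a ℕ.+ b) ℕ.+ (size (proj₁ q) ℕ.+ size (proj₂ q)) ≡ N
              × (∀ {M} → size (proj₁ q) ℕ.+ size (proj₂ q) ≡ M → CPs (suc a) (suc b) M q)
      exact-add (u , v) ((cp , ua , vb) , ua≢0 , vb≢0)
        with u↓ , v↓ , v≤u , u≤v ← parts (u , v) cp
        with addColumn-surjective a u (not-fewer⇒positive u u↓ ua≢0)
           | addColumn-surjective b v (not-fewer⇒positive v v↓ vb≢0)
      ... | u′ , refl | v′ , refl = (u′ , v′) , refl , trans (sym (size-add u′ v′)) (size-of (u , v) cp) ,
        λ eq → isCP u′ v′
          (addColumn-descends⁻ u′ u′ a≤n a≤n (ℕP.m≤m+n a 1) u≡0 u↓)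
          (addColumn-descends⁻ v′ v′ b≤n b≤n (ℕP.m≤m+n b 1) v≡0 v↓)
          (addColumn-descends⁻ v′ u′ a≤n b≤n b≤a+c₂ v≡0 v≤u)
          (addColumn-descends⁻ u′ v′ b≤n a≤n a≤b+c₁ u≡0 u≤v)
          eq
          , trans (sym (part-addColumn-≥ a u′ ℕP.≤-refl)) ua
          , trans (sym (part-addColumn-≥ b v′ ℕP.≤-refl)) vb
        where
        u≡0 : ∀ {j} → a ℕ.≤ j → part (addColumn a u′) j ≡ 0
        u≡0 = fewer⇒zero (addColumn a u′) u↓ {a} ua
        v≡0 : ∀ {j} → b ℕ.≤ j → part (addColumn b v′) j ≡ 0
        v≡0 = fewer⇒zero (addColumn b v′) v↓ {b} vb

    -- The bijection is `add`. Both enumerations are free of duplicates, so it suffices that the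
    -- filtered list and the image under `add` have the same members.
    #Exact-+ : ∀ M → #Exact a b (a ℕ.+ b ℕ.+ M) ≡ #CPs (suc a) (suc b) M
    #Exact-+ M = trans
      (unique-length
        (Unique.filter⁺ (Exact? a b N) (allPairs-unique n N))
        (Unique.map⁺ add-injective (Unique.filter⁺ (CPs? (suc a) (suc b) M) (allPairs-unique n M)))
        to from)
      (ListP.length-map add (filter (CPs? (suc a) (suc b) M) (allPairs n M)))
      where
      N = a ℕ.+ b ℕ.+ M

      to : ∀ {p} → p ∈ filter (Exact? a b N) (allPairs n N) →
           p ∈ map add (filter (CPs? (suc a) (suc b) M) (allPairs n M))
      to {p} p∈ with exact-add p (proj₂ (∈-filter⁻ (Exact? a b N) {xs = allPairs n N} p∈))
      ... | (u , v) , refl , size≡ , cps = ∈-map⁺ add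
        (∈-filter⁺ (CPs? (suc a) (suc b) M) (∈-allPairs u v size≡M) (cps size≡M))
        where
        size≡M : size u ℕ.+ size v ≡ M
        size≡M = ℕP.+-cancelˡ-≡ (a ℕ.+ b) _ _ size≡

      from : ∀ {p} → p ∈ map add (filter (CPs? (suc a) (suc b) M) (allPairs n M)) →
             p ∈ filter (Exact? a b N) (allPairs n N)
      from p∈ with ∈-map⁻ add p∈
      ... | q , q∈ , refl = ∈-filter⁺ (Exact? a b N)
        (∈-allPairs (proj₁ (add q)) (proj₂ (add q)) (size-of (add q) (proj₁ (proj₁ exact)))) exact
        where
        exact : Exact a b N (add q)
        exact = add-exact M q (proj₂ (∈-filter⁻ (CPs? (suc a) (suc b) M) {xs = allPairs n M} q∈))

    #Exact-< : ∀ {N} → N ℕ.< a ℕ.+ b → #Exact a b N ≡ 0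
    #Exact-< {N} N<a+b = cong length (ListP.filter-none (Exact? a b N) (All.universal empty (allPairs n N)))
      where
      empty : ∀ p → ¬ Exact a b N p
      empty p ex with exact-add p ex
      ... | q , _ , refl , _ = ℕP.<⇒≱ N<a+b (ℕP.m≤m+n (a ℕ.+ b) _)

    #Exact-shift : ∀ N → + #Exact a b N ≡ shift (a ℕ.+ b) (F (suc a) (suc b)) N
    #Exact-shift N with ℕP.<-≤-connex N (a ℕ.+ b)
    ... | inj₁ N<a+b = trans (cong +_ (#Exact-< N<a+b)) (sym (shift-< (a ℕ.+ b) (F (suc a) (suc b)) N<a+b))
    ... | inj₂ a+b≤N with ℕP.m≤n⇒∃[o]m+o≡n a+b≤N
    ...   | M , refl = trans (cong +_ (#Exact-+ M)) (sym (shift-+ (a ℕ.+ b) (F (suc a) (suc b)) M))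

    F-rec : F a (suc b) ⊕ F (suc a) b ⊕ shift (a ℕ.+ b) (F (suc a) (suc b)) ≈ F (suc a) (suc b) ⊕ F a b
    F-rec .at N = begin
      + #CPs a (suc b) N ℤ.+ + #CPs (suc a) b N ℤ.+ shift (a ℕ.+ b) (F (suc a) (suc b)) N
        ≡⟨ cong (ℤ._+_ (+ (#CPs a (suc b) N ℕ.+ #CPs (suc a) b N))) (#Exact-shift N) ⟨
      + (#CPs a (suc b) N ℕ.+ #CPs (suc a) b N ℕ.+ #Exact a b N)
        ≡⟨ cong +_ (#-rec a b N) ⟨
      + (#CPs (suc a) (suc b) N ℕ.+ #CPs a b N) ∎

  -- The cylindric inequality at an index where the second partition has run out makes the part of
  -- the first one c₁ places later vanish too.
  F-upper : ∀ b → F (suc (b ℕ.+ c₁)) b ≈ F (b ℕ.+ c₁) b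
  F-upper zero    = ≈-trans (F-zeroʳ (suc c₁)) (≈-sym (F-zeroʳ c₁))
  F-upper (suc b) .at N = cong +_ (length-filter-⇔ (CPs? (suc (suc b ℕ.+ c₁)) (suc b) N) (CPs? (suc b ℕ.+ c₁) (suc b) N)
    (λ (u , v) (cp , _ , vb) → let _ , _ , _ , u≤v = parts (u , v) cp in
      cp , ℕP.n≤0⇒n≡0 (ℕP.≤-trans (u≤v b) (ℕP.≤-reflexive vb)) , vb)
    (λ (u , v) (cp , ua , vb) → cp , fewer-suc u (proj₁ (parts (u , v) cp)) {suc b ℕ.+ c₁} ua , vb)
    (allPairs n N))

  F-lower : ∀ a → F a (suc (a ℕ.+ c₂)) ≈ F a (a ℕ.+ c₂)
  F-lower zero    = ≈-trans (F-zeroˡ (suc c₂)) (≈-sym (F-zeroˡ c₂))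
  F-lower (suc a) .at N = cong +_ (length-filter-⇔ (CPs? (suc a) (suc (suc a ℕ.+ c₂)) N) (CPs? (suc a) (suc a ℕ.+ c₂) N)
    (λ (u , v) (cp , ua , _) → let _ , _ , v≤u , _ = parts (u , v) cp in
      cp , ua , ℕP.n≤0⇒n≡0 (ℕP.≤-trans (v≤u a) (ℕP.≤-reflexive ua)))
    (λ (u , v) (cp , ua , vb) → cp , ua , fewer-suc v (proj₁ (proj₂ (parts (u , v) cp))) {suc a ℕ.+ c₂} vb)
    (allPairs n N))

  F-origin : F 1 1 ≈ oneS
  F-origin .at zero = cong +_ (unique-length (Unique.filter⁺ (CPs? 1 1 0) (allPairs-unique n 0)) (All.[] ∷ []) to from)
    where
    o : Vec ℕ n × Vec ℕ n
    o = replicate n 0 , replicate n 0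

    size-zeros : ∀ m → size (replicate m 0) ≡ 0
    size-zeros zero    = refl
    size-zeros (suc m) = size-zeros m

    part-zeros : ∀ m j → part (replicate m 0) j ≡ 0
    part-zeros zero    j       = refl
    part-zeros (suc m) zero    = refl
    part-zeros (suc m) (suc j) = part-zeros m j

    zeros-descend : ∀ c → Descends c (replicate n 0) (replicate n 0)
    zeros-descend c j = ℕP.≤-reflexive (trans (part-zeros n (j ℕ.+ c)) (sym (part-zeros n j)))

    size-zero⇒zeros : ∀ {m} (v : Vec ℕ m) → size v ≡ 0 → v ≡ replicate m 0
    size-zero⇒zeros []         _  = refl
    size-zero⇒zeros (zero ∷ v) eq = cong (0 ∷_) (size-zero⇒zeros v eq)

    size-o : size (proj₁ o) ℕ.+ size (proj₂ o) ≡ 0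
    size-o = cong₂ ℕ._+_ (size-zeros n) (size-zeros n)

    to : ∀ {p} → p ∈ filter (CPs? 1 1 0) (allPairs n 0) → p ∈ o ∷ []
    to {u , v} p∈ with eq ← size-of (u , v) (proj₁ (proj₂ (∈-filter⁻ (CPs? 1 1 0) {xs = allPairs n 0} p∈))) =
      here (cong₂ _,_ (size-zero⇒zeros u (ℕP.m+n≡0⇒m≡0 (size u) eq)) (size-zero⇒zeros v (ℕP.m+n≡0⇒n≡0 (size u) eq)))

    from : ∀ {p} → p ∈ o ∷ [] → p ∈ filter (CPs? 1 1 0) (allPairs n 0)
    from (here refl) = ∈-filter⁺ (CPs? 1 1 0) (∈-allPairs (proj₁ o) (proj₂ o) size-o)
      (isCP (proj₁ o) (proj₂ o) (zeros-descend 1) (zeros-descend 1) (zeros-descend c₂) (zeros-descend c₁) size-o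
      , part-zeros n 0 , part-zeros n 0)
  F-origin .at (suc N) = cong (λ xs → + length xs)
    (ListP.filter-none (CPs? 1 1 (suc N)) (All.universal empty (allPairs n (suc N))))
    where
    size-zero : ∀ {m} (v : Vec ℕ m) → (∀ j → part v j ≡ 0) → size v ≡ 0
    size-zero []      _   = refl
    size-zero (x ∷ v) v≡0 = cong₂ ℕ._+_ (v≡0 0) (size-zero v (v≡0 ∘ suc))

    empty : ∀ p → ¬ CPs 1 1 (suc N) p
    empty (u , v) (cp , u0 , v0) with u↓ , v↓ , _ ← parts (u , v) cp
      with () ← trans (sym (cong₂ ℕ._+_
        (size-zero u λ _ → fewer⇒zero u u↓ {0} u0 z≤n)
        (size-zero v λ _ → fewer⇒zero v v↓ {0} v0 z≤n))) (size-of (u , v) cp)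

-- Counts and reflected sums agree on the strip

shift-cong-≤ : ∀ m {f g} N → (∀ i → i ℕ.≤ N → f i ≡ g i) → shift m f N ≡ shift m g N
shift-cong-≤ zero    N       f≡g = f≡g N ℕP.≤-refl
shift-cong-≤ (suc m) zero    f≡g = refl
shift-cong-≤ (suc m) (suc N) f≡g = shift-cong-≤ m N λ i i≤N → f≡g i (ℕP.m≤n⇒m≤1+n i≤N)

-- Division by 1 - q^(m+1), one coefficient at a time: the shift is by at least 1, so coefficient N
-- is determined by `u`, `v` and earlier coefficients.
shift-unique : ∀ m {f g} u v → v ⊕ shift (suc m) f ≈ f ⊕ u → v ⊕ shift (suc m) g ≈ g ⊕ u → f ≈ g
shift-unique m {f} {g} u v f-rec g-rec .at N = below N N ℕP.≤-refl
  where
  step : ∀ N → shift (suc m) f N ≡ shift (suc m) g N → f N ≡ g N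
  step N eq = ∙-cancelʳ (u N) (f N) (g N)
    (trans (sym (f-rec .at N)) (trans (cong (ℤ._+_ (v N)) eq) (g-rec .at N)))

  -- `M` bounds the coefficients reached so far; recursion on it is strong induction on `N`.
  below : ∀ M N → N ℕ.≤ M → f N ≡ g N
  below M       zero    _         = step zero refl
  below (suc M) (suc N) (s≤s N≤M) =
    step (suc N) (shift-cong-≤ m N λ i i≤N → below M i (ℕP.≤-trans i≤N N≤M))

module _ (c₁ c₂ n : ℕ) where
  open Strip c₁ c₂
  open Count c₁ c₂ n

  private
    IsNat-∸ : ∀ {m o} → m ℕ.≤ o → IsNat (+ o ℤ.- ℤ.pred (+ m))
    IsNat-∸ {m} m≤o with ℕP.m≤n⇒∃[o]m+o≡n m≤o
    ... | d , refl = suc d , ring (+ m) (+ d)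
      where
      ring : ∀ m d → (m ℤ.+ d) ℤ.- (-1ℤ ℤ.+ m) ≡ 1ℤ ℤ.+ d
      ring = ℤSolver.solve-∀

    pred-+-suc : ∀ a c → ℤ.pred (+ a) ℤ.+ + c ℤ.+ 1ℤ ≡ + (a ℕ.+ c)
    pred-+-suc a c = ring (+ a) (+ c)
      where
      ring : ∀ a c → -1ℤ ℤ.+ a ℤ.+ c ℤ.+ 1ℤ ≡ a ℤ.+ c
      ring = ℤSolver.solve-∀

    -- If b = a + c₂ this neighbour lies outside the strip; the lower wall condition, valid for `F`
    -- and `X` alike, then reduces it to the diagonal neighbour. Otherwise `inside` supplies it.
    left-neighbour : ∀ a b → b ℕ.≤ a ℕ.+ c₂ →
      (suc b ℕ.≤ a ℕ.+ c₂ → F a (suc b) ≈ X (ℤ.pred (+ a)) (+ b)) →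
      F a b ≈ X (ℤ.pred (+ a)) (ℤ.pred (+ b)) → F a (suc b) ≈ X (ℤ.pred (+ a)) (+ b)
    left-neighbour a b b≤a+c₂ inside diagonal with ℕP.m≤n⇒m<n∨m≡n b≤a+c₂
    ... | inj₁ b<a+c₂ = inside b<a+c₂
    ... | inj₂ refl   = ≈-trans (F-lower a) (≈-trans diagonal (≈-sym
      (subst (λ x → X (ℤ.pred (+ a)) x ≈ X (ℤ.pred (+ a)) (ℤ.pred x)) (pred-+-suc a c₂)
        (X-lower (ℤ.pred (+ a))))))

    right-neighbour : ∀ a b → a ℕ.≤ b ℕ.+ c₁ →
      (suc a ℕ.≤ b ℕ.+ c₁ → F (suc a) b ≈ X (+ a) (ℤ.pred (+ b))) →
      F a b ≈ X (ℤ.pred (+ a)) (ℤ.pred (+ b)) → F (suc a) b ≈ X (+ a) (ℤ.pred (+ b))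
    right-neighbour a b a≤b+c₁ inside diagonal with ℕP.m≤n⇒m<n∨m≡n a≤b+c₁
    ... | inj₁ a<b+c₁ = inside a<b+c₁
    ... | inj₂ refl   = ≈-trans (F-upper b) (≈-trans diagonal (≈-sym
      (subst (λ x → X x (ℤ.pred (+ b)) ≈ X (ℤ.pred x) (ℤ.pred (+ b))) (pred-+-suc b c₁)
        (X-upper (ℤ.pred (+ b))))))

    step : ∀ a b m → a ℕ.+ b ≡ suc m → a ℕ.≤ n → b ℕ.≤ n → a ℕ.≤ b ℕ.+ c₁ → b ℕ.≤ a ℕ.+ c₂ →
      F a (suc b) ≈ X (ℤ.pred (+ a)) (+ b) → F (suc a) b ≈ X (+ a) (ℤ.pred (+ b)) →
      F a b ≈ X (ℤ.pred (+ a)) (ℤ.pred (+ b)) → F (suc a) (suc b) ≈ X (+ a) (+ b)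
    step a b m a+b≡ a≤n b≤n a≤b+c₁ b≤a+c₂ left right diagonal = shift-unique m
      (F a b) (F a (suc b) ⊕ F (suc a) b)
      (subst (λ s → F a (suc b) ⊕ F (suc a) b ⊕ shift s (F (suc a) (suc b)) ≈ F (suc a) (suc b) ⊕ F a b)
        a+b≡ (F-rec a≤n b≤n a≤b+c₁ b≤a+c₂))
      (≈-trans (⊕-cong (⊕-cong left right) (≈-refl {shift (suc m) (X (+ a) (+ b))}))
        (≈-trans (X-rec (+ a) (+ b) (cong +_ a+b≡)) (⊕-congˡ (X (+ a) (+ b)) (≈-sym diagonal))))

  -- The recurrence expresses the value at (a, b) through three neighbours with a smaller
  -- coordinate. The strip hypotheses are what `F-rec`, `X-negˡ` and `X-negʳ` require, and the
  -- neighbour lemmas keep the recursion inside the strip.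
  F≈X : ∀ a b → a ℕ.≤ suc n → b ℕ.≤ suc n → a ℕ.≤ b ℕ.+ c₁ → b ℕ.≤ a ℕ.+ c₂ →
    F a b ≈ X (ℤ.pred (+ a)) (ℤ.pred (+ b))
  F≈X zero b _ _ _ b≤c₂ = ≈-trans (F-zeroˡ b) (≈-sym (X-negˡ (ℤ.pred (+ b)) (IsNat-∸ b≤c₂)))
  F≈X (suc a) zero _ _ a≤c₁ _ = ≈-trans (F-zeroʳ (suc a)) (≈-sym (X-negʳ (+ a) (IsNat-∸ a≤c₁)))
  F≈X (suc a) (suc b) (s≤s a≤n) (s≤s b≤n) (s≤s a≤b+c₁) (s≤s b≤a+c₂) with a ℕ.+ b in a+b≡
  ... | suc m = step a b m a+b≡ a≤n b≤n a≤b+c₁ b≤a+c₂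
    (left-neighbour a b b≤a+c₂ (F≈X a (suc b) a≤1+n (s≤s b≤n) (ℕP.m≤n⇒m≤1+n a≤b+c₁)) diagonal)
    (right-neighbour a b a≤b+c₁
      (λ a<b+c₁ → F≈X (suc a) b (s≤s a≤n) b≤1+n a<b+c₁ (ℕP.m≤n⇒m≤1+n b≤a+c₂)) diagonal)
    diagonal
    where
    a≤1+n = ℕP.m≤n⇒m≤1+n a≤n
    b≤1+n = ℕP.m≤n⇒m≤1+n b≤n
    diagonal = F≈X a b a≤1+n b≤1+n a≤b+c₁ b≤a+c₂
  ... | zero with refl ← ℕP.m+n≡0⇒m≡0 a a+b≡ | refl ← ℕP.m+n≡0⇒n≡0 a {b} a+b≡ =
    ≈-trans F-origin (≈-sym X-origin)

  CP≈X : CP c₁ c₂ n ≈ X (+ n) (+ n)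
  CP≈X = ≈-trans CP≈F
    (F≈X (suc n) (suc n) ℕP.≤-refl ℕP.≤-refl (ℕP.m≤m+n (suc n) c₁) (ℕP.m≤m+n (suc n) c₂))

-- The sums of the theorem as values of `X`

-- The prefactor cancels the numerator of the binomial. Out of range, one of the two reciprocals has
-- a negative argument and is 0, like the binomial.
qPochInv-qBinomℤ : ∀ A i → qPochInv A ⊛ qBinomℤ A i ≈ invPoch i ⊛ invPoch (+ A ℤ.- i)
qPochInv-qBinomℤ A -[1+ i ] = ≈-trans (⊛-zeroS (qPochInv A)) (≈-sym (zeroS-⊛ (invPoch (+ A ℤ.- -[1+ i ]))))
qPochInv-qBinomℤ A (+ i) with i ℕ.≤? A
... | yes i≤A = ≈-trans
  (Solver.solve 4 (λ a b c d → a :* (b :* c :* d) := (b :* a) :* (c :* d)) ≈-refl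
    (qPochInv A) (qPoch A) (qPochInv i) (qPochInv (A ℕ.∸ i)))
  (≈-trans (⊛-congʳ (qPochInv i ⊛ qPochInv (A ℕ.∸ i)) (qPoch-qPochInv A))
  (≈-trans (oneS-⊛ (qPochInv i ⊛ qPochInv (A ℕ.∸ i)))
  (⊛-congˡ (qPochInv i) (≡⇒≈ (cong invPoch
    (sym (trans (ℤP.m-n≡m⊖n A i) (ℤP.⊖-≥ i≤A))))))))
... | no i≰A = ≈-trans (⊛-zeroS (qPochInv A)) (≈-sym
  (≈-trans (⊛-congˡ (qPochInv i) (invPoch-neg {+ A ℤ.- + i} negative)) (⊛-zeroS (qPochInv i))))
  where
  negative : IsNat (-1ℤ ℤ.- (+ A ℤ.- + i))
  negative with ℕP.m≤n⇒∃[o]m+o≡n (ℕP.≰⇒> i≰A)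
  ... | o , refl = o , ring (+ A) (+ o)
    where
    ring : ∀ a o → -1ℤ ℤ.- (a ℤ.- (1ℤ ℤ.+ a ℤ.+ o)) ≡ o
    ring = ℤSolver.solve-∀

signPow-even : ∀ k → signPow (+ 2 ℤ.* k) ≡ 1ℤ
signPow-even k = lemma (+ 2 ℤ.* k) (trans (cong (ℕ._% 2) (trans (ℤP.abs-* (+ 2) k) (ℕP.*-comm 2 ∣ k ∣))) (DivMod.m*n%n≡0 ∣ k ∣ 2))
  where
  lemma : ∀ r → ∣ r ∣ ℕ.% 2 ≡ 0 → signPow r ≡ 1ℤ
  lemma r eq with ∣ r ∣ ℕ.% 2
  lemma r refl | .0 = refl

signPow-odd : ∀ k → signPow (+ 2 ℤ.* k ℤ.+ 1ℤ) ≡ -1ℤ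
signPow-odd k = lemma (+ 2 ℤ.* k ℤ.+ 1ℤ) (abs-odd k)
  where
  lemma : ∀ r → (∃ λ m → ∣ r ∣ ≡ 1 ℕ.+ m ℕ.* 2) → signPow r ≡ -1ℤ
  lemma r (m , eq) with ∣ r ∣ ℕ.% 2 | trans (cong (ℕ._% 2) eq) (DivMod.[m+kn]%n≡m%n 1 m 2)
  ... | .1 | refl = refl

  abs-odd : ∀ k → ∃ λ m → ∣ + 2 ℤ.* k ℤ.+ 1ℤ ∣ ≡ 1 ℕ.+ m ℕ.* 2
  abs-odd (+ m) = m , cong ∣_∣ (trans (ring (+ m)) (cong (ℤ._+_ 1ℤ) (sym (ℤP.pos-* m 2))))
    where
    ring : ∀ m → + 2 ℤ.* m ℤ.+ 1ℤ ≡ 1ℤ ℤ.+ m ℤ.* + 2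
    ring = ℤSolver.solve-∀
  abs-odd -[1+ m ] = m , trans (cong ∣_∣ (trans (ring (+ m)) (cong (λ x → ℤ.- (1ℤ ℤ.+ x)) (sym (ℤP.pos-* m 2)))))
    (ℤP.∣-i∣≡∣i∣ (+ (1 ℕ.+ m ℕ.* 2)))
    where
    ring : ∀ m → + 2 ℤ.* (ℤ.- (1ℤ ℤ.+ m)) ℤ.+ 1ℤ ≡ ℤ.- (1ℤ ℤ.+ m ℤ.* + 2)
    ring = ℤSolver.solve-∀

*-/ℕ-cancel : ∀ x d .{{_ : ℕ.NonZero d}} → (x ℤ.* + d) /ℕ d ≡ x
*-/ℕ-cancel (+ m) d = trans (cong (_/ℕ d) (sym (ℤP.pos-* m d))) (cong +_ (DivMod.m*n/n≡m m d))
-- For a negative dividend `_/ℕ_` branches on the remainder, so that has to be rewritten to 0 first.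
*-/ℕ-cancel -[1+ m ] (suc d) with (suc m ℕ.* suc d) ℕ.% suc d | DivMod.m*n%n≡0 (suc m) (suc d)
... | .0 | refl = cong (λ q → ℤ.- (+ q)) (DivMod.m*n/n≡m (suc m) (suc d))

exact-/ℕ : ∀ {x} y d .{{_ : ℕ.NonZero d}} → x ≡ y ℤ.* + d → x /ℕ d ≡ y
exact-/ℕ y d refl = *-/ℕ-cancel y d

-- Rounding down cannot take half of a number ≥ 2m below m. This bounds the exponents for all r at
-- once, before r is split by parity.
half-IsNat : ∀ x m → IsNat (x ℤ.- + 2 ℤ.* + m) → IsNat (x /ℕ 2 ℤ.- + m)
half-IsNat x m (d , eq) = subst (λ y → IsNat (y /ℕ 2 ℤ.- + m)) (sym x≡) (difference m≤)
  where
  ring : ∀ x m → x ≡ m ℤ.* + 2 ℤ.+ (x ℤ.- + 2 ℤ.* m)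
  ring = ℤSolver.solve-∀

  x≡ : x ≡ + (m ℕ.* 2 ℕ.+ d)
  x≡ = trans (ring x (+ m)) (cong₂ ℤ._+_ (sym (ℤP.pos-* m 2)) eq)

  m≤ : m ℕ.≤ (m ℕ.* 2 ℕ.+ d) ℕ./ 2
  m≤ = subst (ℕ._≤ (m ℕ.* 2 ℕ.+ d) ℕ./ 2) (DivMod.m*n/n≡m m 2) (DivMod./-monoˡ-≤ 2 (ℕP.m≤m+n (m ℕ.* 2) d))

  difference : ∀ {q} → m ℕ.≤ q → IsNat (+ q ℤ.- + m)
  difference {q} m≤q = q ℕ.∸ m , trans (ℤP.m-n≡m⊖n q m) (ℤP.⊖-≥ m≤q)

-- `E` and `I` stand for the exponent and the lower binomial index of the theorem, so that both
-- profiles share one argument.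
module _ (c₁ c₂ n : ℕ) (E I : ℤ → ℤ) (grows : Grows E) where
  open Strip c₁ c₂

  private
    summand paired : ℤ → FPS
    summand r = scale (signPow r) (mono (E r)) ⊛ qBinomℤ (2 ℕ.* n) (I r)
    paired r = scale (signPow r) (mono (E r) ⊛ (invPoch (I r) ⊛ invPoch (+ (2 ℕ.* n) ℤ.- I r)))

    scale-supported : ∀ c f N → f N ≡ 0ℤ → scale c f N ≡ 0ℤ
    scale-supported c f N eq = trans (cong (ℤ._*_ c) eq) (ℤP.*-zeroʳ c)

    summand-supported : Supported summand
    summand-supported r N N<r = trans (scale-⊛ (signPow r) (mono (E r)) (qBinomℤ (2 ℕ.* n) (I r)) .at N)
      (scale-supported (signPow r) (mono (E r) ⊛ qBinomℤ (2 ℕ.* n) (I r)) N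
        (mono-supported E grows (λ r → qBinomℤ (2 ℕ.* n) (I r)) r N N<r))

    paired-supported : Supported paired
    paired-supported r N N<r = scale-supported (signPow r) (mono (E r) ⊛ G r) N (mono-supported E grows G r N N<r)
      where
      G : ℤ → FPS
      G r = invPoch (I r) ⊛ invPoch (+ (2 ℕ.* n) ℤ.- I r)

    scale-cong : ∀ c {f g} → f ≈ g → scale c f ≈ scale c g
    scale-cong c f≈g .at N = cong (ℤ._*_ c) (f≈g .at N)

    cancel-qPoch : ∀ r → qPochInv (2 ℕ.* n) ⊛ summand r ≈ paired r
    cancel-qPoch r = ≈-trans
      (⊛-congˡ (qPochInv (2 ℕ.* n)) (scale-⊛ (signPow r) (mono (E r)) B))
      (≈-trans (⊛-comm (qPochInv (2 ℕ.* n)) (scale (signPow r) (mono (E r) ⊛ B)))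
      (≈-trans (scale-⊛ (signPow r) (mono (E r) ⊛ B) (qPochInv (2 ℕ.* n)))
      (scale-cong (signPow r) (≈-trans
        (Solver.solve 3 (λ a b c → (a :* b) :* c := a :* (c :* b)) ≈-refl (mono (E r)) B (qPochInv (2 ℕ.* n)))
        (⊛-congˡ (mono (E r)) (qPochInv-qBinomℤ (2 ℕ.* n) (I r)))))))
      where
      B = qBinomℤ (2 ℕ.* n) (I r)

    2n : + (2 ℕ.* n) ≡ + n ℤ.+ + n
    2n = cong (λ m → + (n ℕ.+ m)) (ℕP.+-identityʳ n)

  module _ (E-even : ∀ k → E (+ 2 ℤ.* k) ≡ e₀ k) (E-odd : ∀ k → E (+ 2 ℤ.* k ℤ.+ 1ℤ) ≡ e₁ k)
           (I-even : ∀ k → I (+ 2 ℤ.* k) ≡ + n ℤ.+ s₀ k) (I-odd : ∀ k → I (+ 2 ℤ.* k ℤ.+ 1ℤ) ≡ + n ℤ.- s₁ k) where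

    private
      even-term : ∀ k → paired (+ 2 ℤ.* k) ≈ Θ₀.weighted (+ n) (+ n) k
      even-term k = ≈-trans
        (≡⇒≈ (cong₂ scale (signPow-even k) (cong₂ _⊛_ (cong mono (E-even k))
          (cong₂ (λ x y → invPoch x ⊛ invPoch y) (I-even k)
            (trans (cong₂ ℤ._-_ 2n (I-even k)) (ring (+ n) (s₀ k)))))))
        (≈-trans (coeffwise λ N → ℤP.*-identityˡ _)
        -- For even r the lower binomial index is the second index of the translate, for odd r the
        -- first.
        (⊛-congˡ (mono (e₀ k)) (⊛-comm (invPoch (+ n ℤ.+ s₀ k)) (invPoch (+ n ℤ.- s₀ k)))))
        where
        ring : ∀ n s → (n ℤ.+ n) ℤ.- (n ℤ.+ s) ≡ n ℤ.- s
        ring = ℤSolver.solve-∀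

      odd-term : ∀ k → paired (+ 2 ℤ.* k ℤ.+ 1ℤ) ≈ scale -1ℤ (Θ₁.weighted (+ n) (+ n) k)
      odd-term k = ≡⇒≈ (cong₂ scale (signPow-odd k) (cong₂ _⊛_ (cong mono (E-odd k))
        (cong₂ (λ x y → invPoch x ⊛ invPoch y) (I-odd k)
          (trans (cong₂ ℤ._-_ 2n (I-odd k)) (ring (+ n) (s₁ k))))))
        where
        ring : ∀ n s → (n ℤ.+ n) ℤ.- (n ℤ.- s) ≡ n ℤ.+ s
        ring = ℤSolver.solve-∀

    bilateral≈X : qPochInv (2 ℕ.* n) ⊛ sumℤ summand ≈ X (+ n) (+ n)
    bilateral≈X = ≈-trans (⊛-sumℤ (qPochInv (2 ℕ.* n)) summand-supported)
      (≈-trans (sumℤ-cong cancel-qPoch)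
      (≈-trans (sumℤ-parity paired-supported)
      (≈-trans (sumℤ-cong {T′ = λ k → Θ₀.weighted (+ n) (+ n) k ⊕ scale -1ℤ (Θ₁.weighted (+ n) (+ n) k)}
                 (λ k → ⊕-cong (even-term k) (odd-term k)))
      (≈-trans (sumℤ-⊕ (Θ₀.weighted (+ n) (+ n)) (λ k → scale -1ℤ (Θ₁.weighted (+ n) (+ n) k)))
      (≈-trans (⊕-congˡ (Θ₀.theta (+ n) (+ n)) (sumℤ-scale -1ℤ (Θ₁.weighted (+ n) (+ n))))
      (coeffwise λ N → cong (ℤ._+_ (Θ₀.theta (+ n) (+ n) N)) (ℤP.-1*i≡-i (Θ₁.theta (+ n) (+ n) N))))))))

-- Both profiles have K = 5. The exponent r(Kr + c₁ - c₂)/2 covers both parities: it is `e₀ k` at r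
-- = 2k and, because K + c₁ - c₂ = 2(c₁ + 1), it is `e₁ k` at r = 2k + 1.
rhs₁≈X : ∀ n → rhs₁ n ≈ Strip.X 2 1 (+ n) (+ n)
rhs₁≈X n = bilateral≈X 2 1 n
  (λ r → (r ℤ.* (+ 5 ℤ.* r ℤ.+ + 1)) /ℕ 2)
  (λ r → (+ 4 ℤ.* + n ℤ.- + 10 ℤ.* r ℤ.+ (signPow r ℤ.- 1ℤ)) /ℕ 4)
  (λ r → half-IsNat (r ℤ.* (+ 5 ℤ.* r ℤ.+ + 1)) ∣ r ∣ (grows r))
  (λ k → exact-/ℕ _ 2 (E-even k)) (λ k → exact-/ℕ _ 2 (E-odd k))
  (λ k → exact-/ℕ _ 4 (trans (cong (λ s → + 4 ℤ.* + n ℤ.- + 10 ℤ.* (+ 2 ℤ.* k) ℤ.+ (s ℤ.- 1ℤ)) (signPow-even k))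
    (I-even (+ n) k)))
  (λ k → exact-/ℕ _ 4 (trans (cong (λ s → + 4 ℤ.* + n ℤ.- + 10 ℤ.* (+ 2 ℤ.* k ℤ.+ 1ℤ) ℤ.+ (s ℤ.- 1ℤ)) (signPow-odd k))
    (I-odd (+ n) k)))
  where
  grows : ∀ r → IsNat (r ℤ.* (+ 5 ℤ.* r ℤ.+ + 1) ℤ.- + 2 ℤ.* + ∣ r ∣)
  grows (+ zero)  = pos 0
  grows (+ suc m) = subst IsNat (sym (ring (+ m))) (pos (suc m) ⟨*⟩ (pos 5 ⟨*⟩ pos m ⟨+⟩ pos 4))
    where
    ring : ∀ m → (1ℤ ℤ.+ m) ℤ.* (+ 5 ℤ.* (1ℤ ℤ.+ m) ℤ.+ + 1) ℤ.- + 2 ℤ.* (1ℤ ℤ.+ m)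
               ≡ (1ℤ ℤ.+ m) ℤ.* (+ 5 ℤ.* m ℤ.+ + 4)
    ring = ℤSolver.solve-∀
  grows -[1+ m ] = subst IsNat (sym (ring (+ m))) (pos (suc m) ⟨*⟩ (pos 5 ⟨*⟩ pos m ⟨+⟩ pos 2))
    where
    ring : ∀ m → (ℤ.- (1ℤ ℤ.+ m)) ℤ.* (+ 5 ℤ.* (ℤ.- (1ℤ ℤ.+ m)) ℤ.+ + 1) ℤ.- + 2 ℤ.* (1ℤ ℤ.+ m)
               ≡ (1ℤ ℤ.+ m) ℤ.* (+ 5 ℤ.* m ℤ.+ + 2)
    ring = ℤSolver.solve-∀

  E-even : ∀ k → (+ 2 ℤ.* k) ℤ.* (+ 5 ℤ.* (+ 2 ℤ.* k) ℤ.+ + 1) ≡ k ℤ.* (+ 2 ℤ.* (k ℤ.* + 5) ℤ.+ 1ℤ) ℤ.* + 2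
  E-even = ℤSolver.solve-∀

  E-odd : ∀ k → (+ 2 ℤ.* k ℤ.+ 1ℤ) ℤ.* (+ 5 ℤ.* (+ 2 ℤ.* k ℤ.+ 1ℤ) ℤ.+ + 1)
              ≡ (+ 2 ℤ.* k ℤ.+ 1ℤ) ℤ.* (k ℤ.* + 5 ℤ.+ + 2 ℤ.+ 1ℤ) ℤ.* + 2
  E-odd = ℤSolver.solve-∀

  I-even : ∀ n k → + 4 ℤ.* n ℤ.- + 10 ℤ.* (+ 2 ℤ.* k) ℤ.+ 0ℤ ≡ (n ℤ.+ ℤ.- (k ℤ.* + 5)) ℤ.* + 4
  I-even = ℤSolver.solve-∀

  I-odd : ∀ n k → + 4 ℤ.* n ℤ.- + 10 ℤ.* (+ 2 ℤ.* k ℤ.+ 1ℤ) ℤ.+ (-1ℤ ℤ.- 1ℤ)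
                ≡ (n ℤ.- (k ℤ.* + 5 ℤ.+ + 2 ℤ.+ 1ℤ)) ℤ.* + 4
  I-odd = ℤSolver.solve-∀

rhs₂≈X : ∀ n → rhs₂ n ≈ Strip.X 3 0 (+ n) (+ n)
rhs₂≈X n = bilateral≈X 3 0 n
  (λ r → (r ℤ.* (+ 5 ℤ.* r ℤ.+ + 3)) /ℕ 2)
  (λ r → (+ 4 ℤ.* + n ℤ.- + 10 ℤ.* r ℤ.+ + 3 ℤ.* (signPow r ℤ.- 1ℤ)) /ℕ 4)
  (λ r → half-IsNat (r ℤ.* (+ 5 ℤ.* r ℤ.+ + 3)) ∣ r ∣ (grows r))
  (λ k → exact-/ℕ _ 2 (E-even k)) (λ k → exact-/ℕ _ 2 (E-odd k))
  (λ k → exact-/ℕ _ 4 (trans (cong (λ s → + 4 ℤ.* + n ℤ.- + 10 ℤ.* (+ 2 ℤ.* k) ℤ.+ + 3 ℤ.* (s ℤ.- 1ℤ)) (signPow-even k))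
    (I-even (+ n) k)))
  (λ k → exact-/ℕ _ 4 (trans (cong (λ s → + 4 ℤ.* + n ℤ.- + 10 ℤ.* (+ 2 ℤ.* k ℤ.+ 1ℤ) ℤ.+ + 3 ℤ.* (s ℤ.- 1ℤ)) (signPow-odd k))
    (I-odd (+ n) k)))
  where
  grows : ∀ r → IsNat (r ℤ.* (+ 5 ℤ.* r ℤ.+ + 3) ℤ.- + 2 ℤ.* + ∣ r ∣)
  grows (+ m) = subst IsNat (sym (ring (+ m))) (pos m ⟨*⟩ (pos 5 ⟨*⟩ pos m ⟨+⟩ pos 1))
    where
    ring : ∀ m → m ℤ.* (+ 5 ℤ.* m ℤ.+ + 3) ℤ.- + 2 ℤ.* m ≡ m ℤ.* (+ 5 ℤ.* m ℤ.+ + 1)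
    ring = ℤSolver.solve-∀
  grows -[1+ m ] = subst IsNat (sym (ring (+ m))) (pos (suc m) ⟨*⟩ (pos 5 ⟨*⟩ pos m))
    where
    ring : ∀ m → (ℤ.- (1ℤ ℤ.+ m)) ℤ.* (+ 5 ℤ.* (ℤ.- (1ℤ ℤ.+ m)) ℤ.+ + 3) ℤ.- + 2 ℤ.* (1ℤ ℤ.+ m)
               ≡ (1ℤ ℤ.+ m) ℤ.* (+ 5 ℤ.* m)
    ring = ℤSolver.solve-∀

  E-even : ∀ k → (+ 2 ℤ.* k) ℤ.* (+ 5 ℤ.* (+ 2 ℤ.* k) ℤ.+ + 3) ≡ k ℤ.* (+ 2 ℤ.* (k ℤ.* + 5) ℤ.+ + 3) ℤ.* + 2
  E-even = ℤSolver.solve-∀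

  E-odd : ∀ k → (+ 2 ℤ.* k ℤ.+ 1ℤ) ℤ.* (+ 5 ℤ.* (+ 2 ℤ.* k ℤ.+ 1ℤ) ℤ.+ + 3)
              ≡ (+ 2 ℤ.* k ℤ.+ 1ℤ) ℤ.* (k ℤ.* + 5 ℤ.+ + 3 ℤ.+ 1ℤ) ℤ.* + 2
  E-odd = ℤSolver.solve-∀

  I-even : ∀ n k → + 4 ℤ.* n ℤ.- + 10 ℤ.* (+ 2 ℤ.* k) ℤ.+ 0ℤ ≡ (n ℤ.+ ℤ.- (k ℤ.* + 5)) ℤ.* + 4
  I-even = ℤSolver.solve-∀

  I-odd : ∀ n k → + 4 ℤ.* n ℤ.- + 10 ℤ.* (+ 2 ℤ.* k ℤ.+ 1ℤ) ℤ.+ + 3 ℤ.* (-1ℤ ℤ.- 1ℤ)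
                ≡ (n ℤ.- (k ℤ.* + 5 ℤ.+ + 3 ℤ.+ 1ℤ)) ℤ.* + 4
  I-odd = ℤSolver.solve-∀

theorem1p1 : (n : ℕ) →
    ((N : ℕ) → CP 2 1 n N ≡ rhs₁ n N) × ((N : ℕ) → CP 3 0 n N ≡ rhs₂ n N)
theorem1p1 n = ≈-trans (CP≈X 2 1 n) (≈-sym (rhs₁≈X n)) .at , ≈-trans (CP≈X 3 0 n) (≈-sym (rhs₂≈X n)) .at
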